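{- Let $\epsilon\in(0,1)$ and consider an instance $(\mathcal X,w,g,\tau)$ of the weighted $k$-submodular cover problem with $|\mathcal X|=n$. Let $\gamma=\min_{x\in\mathcal X}w(x)/\max_{x\in\mathcal X}w(x)$. Algorithm 2 (described in the context) is a $\left(\frac{3-\epsilon}{2\epsilon(1-\epsilon)},\frac{1-\epsilon}{2}\right)$-bicriteria approximation algorithm if $g$ is monotone, and a $\left(\frac{4-\epsilon}{3\epsilon(1-\epsilon)},\frac{1-\epsilon}{3}\right)$-bicriteria approximation algorithm if $g$ is non-monotone. Moreover, the algorithm uses at most $O\!\left(n\,\frac{\ln(\gamma/n)}{\ln(1-\epsilon)}\right)$ memory and makes at most $O\!\left(k\,\frac{\ln(\gamma/n)}{\ln(1-\epsilon)}\right)$ queries per element.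
   Context: Let $k\ge 2$, $[k]=\{1,\dots,k\}$, and let $\mathcal X$ be a finite set. A $k$-set is a tuple $\mathbf s=(S_1,\dots,S_k)$ of pairwise disjoint subsets of $\mathcal X$; the set of all $k$-sets is $(k+1)^{\mathcal X}$, $\mathbf 0=(\emptyset,\dots,\emptyset)$, and $E(\mathbf s)=S_1\cup\dots\cup S_k$. For $k$-sets $\mathbf s,\mathbf t$: $\mathbf s\sqcap\mathbf t=(S_1\cap T_1,\dots,S_k\cap T_k)$, and $\mathbf s\sqcup\mathbf t$ has $i$-th component $(S_i\cup T_i)\setminus\bigcup_{j\ne i}(S_j\cup T_j)$. A function $g:(k+1)^{\mathcal X}\to\mathbb R_+$ ($\mathbb R_+$ the non-negative reals) is $k$-submodular if $g(\mathbf s)+g(\mathbf t)\ge g(\mathbf s\sqcap\mathbf t)+g(\mathbf s\sqcup\mathbf t)$ for all $k$-sets; it is assumed throughout that $g(\mathbf 0)=0$. $\mathbf s\sqsubseteq\mathbf t$ means $S_i\subseteq T_i$ for all $i$; $g$ is monotone if $\mathbf s\sqsubseteq\mathbf t$ implies $g(\mathbf s)\le g(\mathbf t)$. The pair $(x,i)$, $x\in\mathcal X$, $i\in[k]$, also denotes the $k$-set whose $i$-th component is $\{x\}$ and whose other components are empty; for $x\notin E(\mathbf s)$, $\mathbf s\sqcup(x,i)$ is $\mathbf s$ with $x$ added to $S_i$, and $\Delta_{x,i}g(\mathbf s)=g(\mathbf s\sqcup(x,i))-g(\mathbf s)$. Weighted $k$-submodular cover problem: given $w:\mathcal X\to\mathbb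 R_+$, a $k$-submodular function $g:(k+1)^{\mathcal X}\to\mathbb R_+$ with $g(\mathbf 0)=0$, and $\tau\le\max_{\mathbf s}g(\mathbf s)$, minimize $w(\mathbf s)=\sum_{i\in[k]}\sum_{x\in S_i}w(x)$ over all $\mathbf s\in(k+1)^{\mathcal X}$ with $g(\mathbf s)\ge\tau$. Here $\tau>0$ and $w(x)>0$ for all $x$. An algorithm is an $(\alpha,\beta)$-bicriteria approximation if its output $\mathbf x$ satisfies $w(\mathbf x)\le\alpha\,w(\mathbf v)$ and $g(\mathbf x)\ge\beta\tau$, where $\mathbf v$ is an optimal solution. The function $g$ is accessed through an oracle returning $g(\mathbf s)$ for a given $k$-set $\mathbf s$; a query is one oracle call. Memory is measured by the number of stored elements. The $O(\cdot)$ bounds hide absolute constants, in the regime where $\ln(\gamma/n)/\ln(1-\epsilon)\ge 1$. Algorithm 1, input $(\tau,W,\epsilon)$ with $W>0$. Set $\mathbf x:=\mathbf 0$, $\theta:=\epsilon\tau/W$, and $A:=\frac{3-\epsilon}{2\epsilon}W$ if $g$ is monotone, $A:=\frac{4-\epsilon}{3\epsilon}W$ otherwise. Process the elements $x$ of $\mathcal X$ one at a time, each once, in arbitrary order (the stream). For each $x$: let $i'\in\arg\max_{i\in[k]}g((x,i))$; if $w(x)\le A$ and $g((x,i'))\ge\tau$, replace $\mathbf x$ by $(x,i')$. Otherwise let $i'\in\arg\max_{i\in[k]}\Delta_{x,i}g(\mathbf x)$, and if $\Delta_{x,i'}g(\mathbf x)/w(x)\ge\theta$ and $w(\mathbf x)+w(x)\le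 A$, replace $\mathbf x$ by $\mathbf x\sqcup(x,i')$. After all elements are processed, return $\mathbf x$. Ties are broken arbitrarily. Algorithm 2, input $(\tau,\epsilon)$. First pass over the stream: compute $w_{\min}=\min_{x\in\mathcal X}w(x)$ and $w_{\max}=\max_{x\in\mathcal X}w(x)$. Put $\gamma=w_{\min}/w_{\max}$, $l=\ln(\gamma/n)/\ln(1-\epsilon)$, $\lambda_j=(1-\epsilon)^j n w_{\max}$ and $\Lambda=\{\lambda_j: j\text{ integer},\ 0\le j\le l\}$. Second pass: run Algorithm 1 on inputs $(\tau,\lambda_j,\epsilon)$ for all $\lambda_j\in\Lambda$ in parallel (each arriving element is passed to every instance); let $\mathbf x_j$ be the output for $\lambda_j$. Let $r=2$ if $g$ is monotone and $r=3$ otherwise, let $H=\{\mathbf x_j:\lambda_j\in\Lambda,\ g(\mathbf x_j)\ge(1-\epsilon)\tau/r\}$, and return an element of $H$ of minimum cost $w$. -}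

module Defs where

open import Algebra.Bundles using (CommutativeRing; Semiring)
open import Algebra.Structures using (IsCommutativeRing)
open import Data.Bool.Base using (Bool; _∧_; if_then_else_)
open import Data.Empty using (⊥-elim-irr)
open import Data.Fin.Base using (Fin)
open import Data.Fin.Properties using (_≟_)
open import Data.Fin.Subset using (Subset; _∈_; _∉_; ⁅_⁆; _∩_; _∪_; _─_; ⋃; Empty; _⊆_; ∣_∣) renaming (⊥ to ∅)
open import Data.Fin.Subset.Properties using (_∈?_; ∉⊥; x∈p∩q⁻; x∈p∩q⁺; p─q⊆p; x∈p∪q⁺)
open import Data.List.Base as List using (List; []; _∷_; allFin; filter; upTo)
open import Data.List.Membership.Propositional using () renaming (_∈_ to _∈ᴸ_)
open import Data.List.Membership.Propositional.Properties using (∈-map⁺; ∈-filter⁺; ∈-allFin)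
open import Data.List.Relation.Unary.Any using (here; there)
open import Data.Maybe.Base using (Maybe; just; nothing; maybe′)
open import Data.Nat.Base as ℕ using (ℕ; zero; suc)
open import Data.Product.Base using (∃; _×_; _,_; proj₁; proj₂)
open import Data.Sum.Base using (inj₁; inj₂)
open import Data.Vec.Base as Vec using (Vec; []; _∷_; lookup; tabulate; toList)
open import Data.Vec.Properties using (lookup∘tabulate)
open import Function.Base using (_∘_)
open import Level using (0ℓ)
open import Relation.Binary.Bundles using (DecTotalOrder)
open import Relation.Binary.PropositionalEquality using (_≡_; _≢_; refl; sym; subst₂)
open import Relation.Binary.Structures using (IsDecTotalOrder)
open import Relation.Nullary.Decidable using (yes; no; ⌊_⌋; ¬?)
import Algebra.Construct.NaturalChoice.Max as Max
import Algebra.Construct.NaturalChoice.Min as Min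
import Algebra.Definitions.RawSemiring as RawSemiringOps

-- `_⁻¹` is total; nothing is assumed about 0# ⁻¹.
record OrderedField : Set₁ where
  infix  4 _≤_ _<_
  infixl 6 _+_ _-_
  infixl 7 _*_ _/_
  infix  8 -_
  infix  9 _⁻¹
  field
    ℝ                 : Set
    _+_ _*_           : ℝ → ℝ → ℝ
    -_ _⁻¹            : ℝ → ℝ
    0# 1#             : ℝ
    isCommutativeRing : IsCommutativeRing _≡_ _+_ _*_ -_ 0# 1#
    0≢1               : 0# ≢ 1#
    ⁻¹-inverse        : ∀ {x} → x ≢ 0# → x * x ⁻¹ ≡ 1#
    _≤_               : ℝ → ℝ → Set
    isDecTotalOrder   : IsDecTotalOrder _≡_ _≤_
    +-monoˡ-≤         : ∀ z {x y} → x ≤ y → x + z ≤ y + z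
    *-nonNeg          : ∀ {x y} → 0# ≤ x → 0# ≤ y → 0# ≤ x * y

  commutativeRing : CommutativeRing 0ℓ 0ℓ
  commutativeRing = record { isCommutativeRing = isCommutativeRing }

  decTotalOrder : DecTotalOrder 0ℓ 0ℓ 0ℓ
  decTotalOrder = record { isDecTotalOrder = isDecTotalOrder }

  open DecTotalOrder decTotalOrder public using (_≤?_; totalOrder)
  open RawSemiringOps (Semiring.rawSemiring (CommutativeRing.semiring commutativeRing)) public
    using (_^_; sum) renaming (_×_ to _·_)
  open Min totalOrder public using () renaming (_⊓_ to min)
  open Max totalOrder public using () renaming (_⊔_ to max)

  _<_ : ℝ → ℝ → Set
  x < y = x ≤ y × x ≢ y

  _-_ _/_ : ℝ → ℝ → ℝ
  x - y = x + - y
  x / y = x * y ⁻¹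

  fromℕ : ℕ → ℝ
  fromℕ m = m · 1#

  IsMinimum IsMaximum : {A : Set} → (A → ℝ) → ℝ → Set
  IsMinimum f m = (∃ λ a → f a ≡ m) × (∀ a → m ≤ f a)
  IsMaximum f m = (∃ λ a → f a ≡ m) × (∀ a → f a ≤ m)

  Cauchy : (ℕ → ℝ) → Set
  Cauchy a = ∀ δ → 0# < δ → ∃ λ N → ∀ p q → N ℕ.≤ p → N ℕ.≤ q → a p - a q < δ

  _⟶_ : (ℕ → ℝ) → ℝ → Set
  a ⟶ L = ∀ δ → 0# < δ → ∃ λ N → ∀ p → N ℕ.≤ p → (a p - L < δ) × (L - a p < δ)

-- The real numbers with the natural logarithm, given by axioms that determine
-- them up to unique isomorphism.  As in classical mathematics, the order is
-- decidable.
record RealField : Set₁ where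
  field
    orderedField : OrderedField
  open OrderedField orderedField public
  field
    archimedean : ∀ x → ∃ λ m → x ≤ fromℕ m
    complete    : ∀ a → Cauchy a → ∃ λ L → a ⟶ L

    -- The two laws force the derivative of ln at 1# to be 1#, so that ln is
    -- the logarithm to base e.  Nothing is assumed about ln x for x ≤ 0#.
    ln          : ℝ → ℝ
    ln-*        : ∀ {x y} → 0# < x → 0# < y → ln (x * y) ≡ ln x + ln y
    ln≤x-1      : ∀ {x} → 0# < x → ln x ≤ x - 1#

-- The disjointness proof is irrelevant, so k-sets with the same parts are
-- propositionally equal.
record KSet (n k : ℕ) : Set where
  constructor kset
  field
    parts     : Vec (Subset n) k
    .disjoint : ∀ {i j} → i ≢ j → Empty (lookup parts i ∩ lookup parts j)

  part : Fin k → Subset n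
  part = lookup parts

  E : Subset n
  E = ⋃ (toList parts)

open KSet public using (part; E)

part-disjoint : ∀ {n k} (s : KSet n k) {i j} → i ≢ j → Empty (part s i ∩ part s j)
part-disjoint (kset _ d) i≢j x∈ = ⊥-elim-irr (d i≢j x∈)

private
  ∈⋃ : ∀ {n} {x : Fin n} {p : Subset n} {ps} → p ∈ᴸ ps → x ∈ p →
       x ∈ ⋃ ps
  ∈⋃ (here refl) x∈p = x∈p∪q⁺ (inj₁ x∈p)
  ∈⋃ (there p∈) x∈p = x∈p∪q⁺ (inj₂ (∈⋃ p∈ x∈p))

  x∈p─q⇒x∉q : ∀ {n} {x : Fin n} (p q : Subset n) → x ∈ (p ─ q) →
              x ∉ q
  x∈p─q⇒x∉q (_ ∷ p) (_ ∷ q) (Vec.there x∈) (Vec.there x∈q) = x∈p─q⇒x∉q p q x∈ x∈q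

  tabulated : ∀ {n k} (f : Fin k → Subset n) →
              (∀ {i j} → i ≢ j → Empty (f i ∩ f j)) →
              ∀ {i j} → i ≢ j → Empty (lookup (tabulate f) i ∩ lookup (tabulate f) j)
  tabulated f d {i} {j} i≢j =
    subst₂ (λ p q → Empty (p ∩ q)) (sym (lookup∘tabulate f i)) (sym (lookup∘tabulate f j)) (d i≢j)

module _ {n k : ℕ} where

  infix  4 _⊑_
  infixr 7 _⊓_
  infixr 6 _⊔_

  _⊑_ : KSet n k → KSet n k → Set
  s ⊑ t = ∀ i → part s i ⊆ part t i

  𝟎 : KSet n k
  𝟎 = kset (tabulate λ _ → ∅)
           (tabulated (λ _ → ∅) λ _ (_ , x∈) → ∉⊥ (proj₁ (x∈p∩q⁻ ∅ ∅ x∈)))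

  _⊓_ : KSet n k → KSet n k → KSet n k
  s ⊓ t = kset (tabulate m) (tabulated m m-disjoint)
    where
    m : Fin k → Subset n
    m i = part s i ∩ part t i

    m-disjoint : ∀ {i j} → i ≢ j → Empty (m i ∩ m j)
    m-disjoint {i} {j} i≢j (x , x∈) with x∈p∩q⁻ (m i) (m j) x∈
    ... | x∈i , x∈j = part-disjoint s i≢j (x , x∈p∩q⁺
      ( proj₁ (x∈p∩q⁻ (part s i) (part t i) x∈i)
      , proj₁ (x∈p∩q⁻ (part s j) (part t j) x∈j)))

  _⊔_ : KSet n k → KSet n k → KSet n k
  s ⊔ t = kset (tabulate r) (tabulated r r-disjoint)
    where
    u : Fin k → Subset n
    u i = part s i ∪ part t i

    others : Fin k → Subset n
    others i = ⋃ (List.map u (filter (λ j → ¬? (j ≟ i)) (allFin k)))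

    r : Fin k → Subset n
    r i = u i ─ others i

    r-disjoint : ∀ {i j} → i ≢ j → Empty (r i ∩ r j)
    r-disjoint {i} {j} i≢j (x , x∈) with x∈p∩q⁻ (r i) (r j) x∈
    ... | x∈ri , x∈rj = x∈p─q⇒x∉q (u j) (others j) x∈rj
      (∈⋃ (∈-map⁺ u (∈-filter⁺ (λ l → ¬? (l ≟ j)) (∈-allFin i) i≢j))
          (p─q⊆p (u i) (others i) x∈ri))

  single : Fin n → Fin k → KSet n k
  single x i = kset (tabulate c) (tabulated c c-disjoint)
    where
    c : Fin k → Subset n
    c j = if ⌊ j ≟ i ⌋ then ⁅ x ⁆ else ∅

    c-disjoint : ∀ {j l} → j ≢ l → Empty (c j ∩ c l)
    c-disjoint {j} {l} j≢l (y , y∈) with j ≟ i | l ≟ i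
    ... | yes refl | yes refl = j≢l refl
    ... | yes _    | no  _    = ∉⊥ (proj₂ (x∈p∩q⁻ ⁅ x ⁆ ∅ y∈))
    ... | no  _    | yes _    = ∉⊥ (proj₁ (x∈p∩q⁻ ∅ ⁅ x ⁆ y∈))
    ... | no  _    | no  _    = ∉⊥ (proj₁ (x∈p∩q⁻ ∅ ∅ y∈))

module _ ⦃ ℛ : RealField ⦄ {n k : ℕ} where
  open RealField ℛ

  Monotone : (KSet n k → ℝ) → Set
  Monotone g = ∀ s t → s ⊑ t → g s ≤ g t

  KSubmodular : (KSet n k → ℝ) → Set
  KSubmodular g = ∀ s t → g (s ⊓ t) + g (s ⊔ t) ≤ g s + g t

  weight : (Fin n → ℝ) → KSet n k → ℝ
  weight w s = sum λ i → sum λ x → if ⌊ x ∈? part s i ⌋ then w x else 0#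

module _ ⦃ ℛ : RealField ⦄ (n k : ℕ) where
  open RealField ℛ

  record Instance : Set where
    field
      w           : Fin n → ℝ
      g           : KSet n k → ℝ
      τ           : ℝ
      w-positive  : ∀ x → 0# < w x
      g-nonNeg    : ∀ s → 0# ≤ g s
      g-𝟎         : g 𝟎 ≡ 0#
      kSubmodular : KSubmodular g
      τ-positive  : 0# < τ
      τ≤max       : ∃ λ M → IsMaximum g M × τ ≤ M

    Optimal : KSet n k → Set
    Optimal v = τ ≤ g v × (∀ s → τ ≤ g s → weight w v ≤ weight w s)

    -- `nothing` stands for a run that fails to return a solution.
    Bicriteria : ℝ → ℝ → Maybe (KSet n k) → Set
    Bicriteria α β out = ∃ λ x → out ≡ just x
      × (∀ v → Optimal v → weight w x ≤ α * weight w v)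
      × β * τ ≤ g x

open Instance public using (w; g; τ; Bicriteria)

-- Programs that reach the function g only through oracle calls (`query`) and
-- that may choose any maximiser of a finite family (`pick`); the latter models
-- arbitrary tie-breaking.
module Oracle ⦃ ℛ : RealField ⦄ (Q : Set) where
  open RealField ℛ

  data Prog (A : Set) : Set where
    return : A → Prog A
    query  : Q → (ℝ → Prog A) → Prog A
    pick   : ∀ {m} → (Fin m → ℝ) → (Fin m → Prog A) → Prog A

  infixl 1 _>>=_
  _>>=_ : ∀ {A B} → Prog A → (A → Prog B) → Prog B
  return a  >>= h = h a
  query s p >>= h = query s λ v → p v >>= h
  pick f p  >>= h = pick f λ i → p i >>= h

  ask : Q → Prog ℝ
  ask s = query s return

  askAll : ∀ {m} → (Fin m → Q) → Prog (Vec ℝ m)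
  askAll {zero}  s = return []
  askAll {suc m} s = do
    v  ← ask (s Fin.zero)
    vs ← askAll (s ∘ Fin.suc)
    return (v ∷ vs)

  argmax : ∀ {m} → (Fin m → ℝ) → Prog (Fin m)
  argmax f = pick f return

  -- g ⊢ p ⇓ a # q : with oracle g, some execution of p returns a after q queries.
  infix 3 _⊢_⇓_#_
  data _⊢_⇓_#_ {A : Set} (g : Q → ℝ) : Prog A → A → ℕ → Set where
    return : ∀ {a} → g ⊢ return a ⇓ a # 0
    query  : ∀ {s p a q} → g ⊢ p (g s) ⇓ a # q → g ⊢ query s p ⇓ a # suc q
    pick   : ∀ {m} {f : Fin m → ℝ} {p a q} i → (∀ j → f j ≤ f i) →
             g ⊢ p i ⇓ a # q → g ⊢ pick f p ⇓ a # q

  -- Pass g stored step st xs st′ m q : one pass over the stream xs takes the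
  -- state st to st′, with at most m elements stored at any time and at most q
  -- queries on any one element.  While an element is processed, that element
  -- and the states before and after it are all counted as stored.
  data Pass {S X : Set} (g : Q → ℝ) (stored : S → ℕ) (step : X → S → Prog S) :
            S → List X → S → ℕ → ℕ → Set where
    []  : ∀ {st} → Pass g stored step st [] st (stored st) 0
    _∷_ : ∀ {st x st′ xs st″ q m q′} →
          g ⊢ step x st ⇓ st′ # q →
          Pass g stored step st′ xs st″ m q′ →
          Pass g stored step st (x ∷ xs) st″
               ((1 ℕ.+ stored st ℕ.+ stored st′) ℕ.⊔ m) (q ℕ.⊔ q′)

-- The flag `mono` says whether g is monotone.
module Algorithms ⦃ ℛ : RealField ⦄ {n k : ℕ}
                  (w : Fin n → RealField.ℝ ℛ) (τ ε : RealField.ℝ ℛ) (mono : Bool) where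
  open RealField ℛ
  open Oracle (KSet n k)

  module Algorithm₁ (W : ℝ) where

    θ A : ℝ
    θ = ε * τ / W
    A = if mono then (fromℕ 3 - ε) / (fromℕ 2 * ε) * W
                else (fromℕ 4 - ε) / (fromℕ 3 * ε) * W

    initial : KSet n k
    initial = 𝟎

    process : Fin n → KSet n k → Prog (KSet n k)
    process x s = do
      singles ← askAll (λ i → single x i)
      i ← argmax (lookup singles)
      if ⌊ w x ≤? A ⌋ ∧ ⌊ τ ≤? lookup singles i ⌋
        then return (single x i)
        else do
          gs ← ask s
          extensions ← askAll (λ i → s ⊔ single x i)
          let Δ = λ i → lookup extensions i - gs
          i′ ← argmax Δ
          if ⌊ θ ≤? Δ i′ / w x ⌋ ∧ ⌊ weight w s + w x ≤? A ⌋
            then return (s ⊔ single x i′)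
            else return s

  module Algorithm₂ where

    Extrema : Set
    Extrema = Maybe (ℝ × ℝ)

    scan : Fin n → Extrema → Prog Extrema
    scan x nothing                = return (just (w x , w x))
    scan x (just (w-min , w-max)) = return (just (min w-min (w x) , max w-max (w x)))

    storedExtrema : Extrema → ℕ
    storedExtrema = maybe′ (λ _ → 2) 0

    thresholds : ℝ → ℝ → List ℝ
    thresholds w-min w-max =
      List.map (λ j → (1# - ε) ^ j * fromℕ n * w-max)
               (filter (λ j → fromℕ j ≤? l) (upTo (suc (proj₁ (archimedean l)))))
      where
      γ l : ℝ
      γ = w-min / w-max
      l = ln (γ / fromℕ n) / ln (1# - ε)

    -- One pair (λⱼ , current solution) for each parallel run of Algorithm₁.
    Runs : Set
    Runs = List (ℝ × KSet n k)

    start : Extrema → Runs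
    start nothing                = []
    start (just (w-min , w-max)) =
      List.map (λ W → W , Algorithm₁.initial W) (thresholds w-min w-max)

    processAll : Fin n → Runs → Prog Runs
    processAll x []             = return []
    processAll x ((W , s) ∷ rs) = do
      s′  ← Algorithm₁.process W x s
      rs′ ← processAll x rs
      return ((W , s′) ∷ rs′)

    storedRuns : Runs → ℕ
    storedRuns = List.sum ∘ List.map (λ (_ , s) → ∣ E s ∣)

    r : ℝ
    r = if mono then fromℕ 2 else fromℕ 3

    acceptable : Runs → Prog (List (KSet n k))
    acceptable []             = return []
    acceptable ((_ , s) ∷ rs) = do
      gs ← ask s
      H  ← acceptable rs
      return (if ⌊ (1# - ε) * τ / r ≤? gs ⌋ then s ∷ H else H)

    cheapest : List (KSet n k) → Prog (Maybe (KSet n k))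
    cheapest []         = return nothing
    cheapest H@(_ ∷ _) = do
      i ← argmax (λ i → - weight w (List.lookup H i))
      return (just (List.lookup H i))

    finish : Runs → Prog (Maybe (KSet n k))
    finish rs = acceptable rs >>= cheapest

    -- Run g σ out m q : on the stream σ the algorithm may return out, storing at
    -- most m elements, with at most q queries per element.  The queries of the
    -- final selection are charged in full to every element.
    data Run (g : KSet n k → ℝ) (σ : List (Fin n)) : Maybe (KSet n k) → ℕ → ℕ → Set where
      run : ∀ {extrema runs out m₁ m₂ q₁ q₂ q₃} →
            Pass g storedExtrema scan nothing σ extrema m₁ q₁ →
            Pass g storedRuns processAll (start extrema) σ runs m₂ q₂ →
            g ⊢ finish runs ⇓ out # q₃ →
            Run g σ out (m₁ ℕ.⊔ m₂) (q₁ ℕ.+ q₂ ℕ.+ q₃)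

open RealField ⦃ ... ⦄ public

{-# OPTIONS --safe #-}

-- View k-sets as partial colourings of the ground set by the k colours, so that
-- ⊓ and ⊔ become pointwise and k-submodularity yields diminishing marginal gains
-- and pairwise monotonicity (two different colours never both lose).
--
-- Let b = 0 if g is monotone and b = 1 otherwise, and ρ = 2 + b.  Run Algorithm 1
-- with W ≥ w(v) for a solution v, and let f be its current colouring.  Overriding
-- v by f, one greedy choice at a time, costs at most (1 + b) times the marginal
-- gain of each choice, so g(v) ≤ g(f ▹ v) + (1 + b) g(f).  At the end every element
-- of v outside f was rejected for its density, so g(f ▹ v) ≤ g(f) + θ w(v)
-- ≤ g(f) + ε τ, and hence (1 - ε) τ ≤ ρ g(f).  If instead an element of v was
-- rejected because of the budget A, its single value is below τ and the density of
-- f alone gives θ A ≤ g(f) + τ, which is the same bound; and if a singleton of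
-- value τ was ever taken there is nothing to prove.
--
-- Some threshold satisfies (1 - ε) λⱼ ≤ w(v) ≤ λⱼ, because the thresholds descend
-- geometrically from n w-max to w-min; this turns the budget A into the factor of
-- the theorem.  There are at most 1 + l ≤ 2 l thresholds.
module Submission where

open import Defs
open import Algebra.Bundles using (CommutativeRing; RawRing)
import Algebra.Construct.NaturalChoice.Max as Max
import Algebra.Construct.NaturalChoice.Min as Min
import Algebra.Properties.CommutativeMonoid.Sum
import Algebra.Properties.Ring
import Algebra.Properties.Semiring.Mult
import Algebra.Solver.Ring
import Algebra.Solver.Ring.AlmostCommutativeRing as ACR
open import Data.Bool.Base using (Bool; true; false; if_then_else_; _∧_)
open import Data.Empty using (⊥-elim)
open import Data.Fin.Base as Fin using (Fin; zero; suc)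
open import Data.Fin.Properties as Fin using (any?; ¬∀⟶∃¬)
open import Data.Fin.Subset using (Subset; _∈_; _∉_; ⁅_⁆; _∪_; _─_; ⋃; ∣_∣) renaming (⊥ to ∅)
open import Data.Fin.Subset.Properties
  using (_∈?_; ∉⊥; x∈p∩q⁻; x∈p∩q⁺; p─q⊆p; x∈p∪q⁺; x∈p∪q⁻; x∈p∧x∉q⇒x∈p─q; ⊆-antisym; x∈⁅x⁆; x∈⁅y⁆⇒x≡y; ∣p∣≤n)
open import Data.Integer.Base as ℤ using (ℤ; -[1+_]; _⊖_) renaming (+_ to pos)
import Data.Integer.Properties as ℤ
open import Data.List.Base as List using (List; []; _∷_; allFin; filter; length; upTo)
open import Data.List.Membership.Propositional using () renaming (_∈_ to _∈ᴸ_; _∉_ to _∉ᴸ_)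
open import Data.List.Membership.Propositional.Properties
  using (∈-map⁺; ∈-map⁻; ∈-filter⁺; ∈-filter⁻; ∈-allFin; ∈-upTo⁺; ∈-lookup)
open import Data.List.Properties
  using (length-map; length-filter; length-upTo; filter-++; upTo-∷ʳ; filter-reject; ++-identityʳ; map-∘; map-id)
open import Data.List.Relation.Binary.Permutation.Propositional using (_↭_; ↭-sym; ↭⇒↭ₛ)
open import Data.List.Relation.Binary.Permutation.Propositional.Properties using (∈-resp-↭)
import Data.List.Relation.Binary.Permutation.Setoid.Properties as Permutation
open import Data.List.Relation.Unary.All as All using (All; []; _∷_)
import Data.List.Relation.Unary.All.Properties as All
open import Data.List.Relation.Unary.AllPairs using (_∷_)
open import Data.List.Relation.Unary.Any as Any using (here; there)
import Data.List.Relation.Unary.Any.Properties as Any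
open import Data.List.Relation.Unary.Unique.Propositional using (Unique)
open import Data.List.Relation.Unary.Unique.Propositional.Properties using (allFin⁺; Unique[x∷xs]⇒x∉xs)
open import Data.Maybe.Base using (Maybe; just; nothing; _<∣>_)
open import Data.Maybe.Properties using (just-injective; ≡-dec)
open import Data.Nat.Base as ℕ using (ℕ; zero; suc)
import Data.Nat.Properties as ℕ
open import Data.Product.Base using (∃; _×_; _,_; proj₁; proj₂)
open import Data.Sum.Base using (_⊎_; inj₁; inj₂; [_,_]′)
open import Data.Vec.Base as Vec using (Vec; []; _∷_; lookup; tabulate)
open import Data.Vec.Properties using (lookup∘tabulate; tabulate∘lookup; tabulate-cong; []=⇒lookup; lookup⇒[]=)
open import Function.Base using (_∘_; _$_; const; id; case_of_)
open import Relation.Binary.Bundles using (DecTotalOrder)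
open import Relation.Binary.PropositionalEquality
  using (_≡_; _≢_; _≗_; refl; sym; trans; cong; cong₂; subst; subst₂; setoid; module ≡-Reasoning)
open import Relation.Nullary.Decidable using (Dec; ⌊_⌋; yes; no; ¬?; does; dec-true)
open import Relation.Nullary.Negation using (¬_; contradiction)

-- Ordered-field arithmetic, a ring solver with integer coefficients, and logarithms.

module Arithmetic ⦃ ℛ : RealField ⦄ where
  open CommutativeRing commutativeRing public using
    ( +-assoc; +-comm; +-identityˡ; +-identityʳ; *-assoc; *-comm; *-identityˡ; *-identityʳ
    ; distribˡ; distribʳ; zeroˡ; -‿inverseʳ; ring; semiring)
  open Algebra.Properties.Ring ring public using (-‿distribˡ-*; -‿distribʳ-*; -‿involutive; -‿+-comm; -0#≈0#)
  open Algebra.Properties.Semiring.Mult semiring using (×-homo-+; ×1-homo-*)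
  open DecTotalOrder decTotalOrder public using ()
    renaming (refl to ≤-refl; reflexive to ≤-reflexive; trans to ≤-trans; antisym to ≤-antisym; total to ≤-total)

  module Solver where
    ℤ-rawRing : RawRing _ _
    ℤ-rawRing = CommutativeRing.rawRing ℤ.+-*-commutativeRing

    -- The separate clause for one makes the numeral 1 denote `1#` itself and not `1# + 0#`, so that
    -- `1-homo` holds by `refl` and `con (pos 1)` is literally `1#`.
    ⟦_⟧ℕ : ℕ → ℝ
    ⟦ zero ⟧ℕ        = 0#
    ⟦ suc zero ⟧ℕ    = 1#
    ⟦ suc (suc m) ⟧ℕ = 1# + ⟦ suc m ⟧ℕ

    ⟦_⟧ℤ : ℤ → ℝ
    ⟦ pos m ⟧ℤ      = ⟦ m ⟧ℕ
    ⟦ -[1+ m ] ⟧ℤ = - ⟦ suc m ⟧ℕ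

    ⟦suc⟧ : ∀ m → ⟦ suc m ⟧ℕ ≡ 1# + ⟦ m ⟧ℕ
    ⟦suc⟧ zero    = sym (+-identityʳ 1#)
    ⟦suc⟧ (suc m) = refl

    open ≡-Reasoning

    ⟦+⟧ℕ : ∀ m p → ⟦ m ℕ.+ p ⟧ℕ ≡ ⟦ m ⟧ℕ + ⟦ p ⟧ℕ
    ⟦+⟧ℕ zero    p = sym (+-identityˡ _)
    ⟦+⟧ℕ (suc m) p = begin
      ⟦ suc (m ℕ.+ p) ⟧ℕ       ≡⟨ ⟦suc⟧ (m ℕ.+ p) ⟩
      1# + ⟦ m ℕ.+ p ⟧ℕ        ≡⟨ cong (1# +_) (⟦+⟧ℕ m p) ⟩
      1# + (⟦ m ⟧ℕ + ⟦ p ⟧ℕ)   ≡⟨ +-assoc _ _ _ ⟨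
      1# + ⟦ m ⟧ℕ + ⟦ p ⟧ℕ     ≡⟨ cong (_+ ⟦ p ⟧ℕ) (⟦suc⟧ m) ⟨
      ⟦ suc m ⟧ℕ + ⟦ p ⟧ℕ      ∎

    ⟦*⟧ℕ : ∀ m p → ⟦ m ℕ.* p ⟧ℕ ≡ ⟦ m ⟧ℕ * ⟦ p ⟧ℕ
    ⟦*⟧ℕ zero    p = sym (zeroˡ _)
    ⟦*⟧ℕ (suc m) p = begin
      ⟦ p ℕ.+ m ℕ.* p ⟧ℕ                 ≡⟨ ⟦+⟧ℕ p (m ℕ.* p) ⟩
      ⟦ p ⟧ℕ + ⟦ m ℕ.* p ⟧ℕ              ≡⟨ cong₂ _+_ (sym (*-identityˡ _)) (⟦*⟧ℕ m p) ⟩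
      1# * ⟦ p ⟧ℕ + ⟦ m ⟧ℕ * ⟦ p ⟧ℕ      ≡⟨ distribʳ _ _ _ ⟨
      (1# + ⟦ m ⟧ℕ) * ⟦ p ⟧ℕ             ≡⟨ cong (_* ⟦ p ⟧ℕ) (⟦suc⟧ m) ⟨
      ⟦ suc m ⟧ℕ * ⟦ p ⟧ℕ                ∎

    ⟦⊖⟧ : ∀ m p → ⟦ m ⊖ p ⟧ℤ ≡ ⟦ m ⟧ℕ - ⟦ p ⟧ℕ
    ⟦⊖⟧ m       zero    = sym (trans (cong (⟦ m ⟧ℕ +_) -0#≈0#) (+-identityʳ _))
    ⟦⊖⟧ zero    (suc p) = sym (+-identityˡ _)
    ⟦⊖⟧ (suc m) (suc p) = begin
      ⟦ suc m ⊖ suc p ⟧ℤ                        ≡⟨ cong ⟦_⟧ℤ (ℤ.[1+m]⊖[1+n]≡m⊖n m p) ⟩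
      ⟦ m ⊖ p ⟧ℤ                                ≡⟨ ⟦⊖⟧ m p ⟩
      ⟦ m ⟧ℕ - ⟦ p ⟧ℕ                           ≡⟨ cong (_- ⟦ p ⟧ℕ) (+-identityʳ _) ⟨
      ⟦ m ⟧ℕ + 0# - ⟦ p ⟧ℕ                      ≡⟨ cong (λ z → ⟦ m ⟧ℕ + z - ⟦ p ⟧ℕ) (-‿inverseʳ 1#) ⟨
      ⟦ m ⟧ℕ + (1# - 1#) - ⟦ p ⟧ℕ               ≡⟨ cong (_- ⟦ p ⟧ℕ) (+-assoc _ _ _) ⟨
      ⟦ m ⟧ℕ + 1# - 1# - ⟦ p ⟧ℕ                 ≡⟨ +-assoc _ _ _ ⟩
      ⟦ m ⟧ℕ + 1# + (- 1# - ⟦ p ⟧ℕ)             ≡⟨ cong₂ _+_ (+-comm _ _) (-‿+-comm 1# ⟦ p ⟧ℕ) ⟩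
      1# + ⟦ m ⟧ℕ - (1# + ⟦ p ⟧ℕ)               ≡⟨ cong₂ _-_ (⟦suc⟧ m) (⟦suc⟧ p) ⟨
      ⟦ suc m ⟧ℕ - ⟦ suc p ⟧ℕ                   ∎

    ⟦-⟧ : ∀ a → ⟦ ℤ.- a ⟧ℤ ≡ - ⟦ a ⟧ℤ
    ⟦-⟧ (pos zero)  = sym -0#≈0#
    ⟦-⟧ (pos (suc m)) = refl
    ⟦-⟧ -[1+ m ]  = sym (-‿involutive _)

    ⟦+⟧ : ∀ a c → ⟦ a ℤ.+ c ⟧ℤ ≡ ⟦ a ⟧ℤ + ⟦ c ⟧ℤ
    ⟦+⟧ (pos m)    (pos p)    = ⟦+⟧ℕ m p
    ⟦+⟧ (pos m)    -[1+ p ] = ⟦⊖⟧ m (suc p)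
    ⟦+⟧ -[1+ m ] (pos p)    = trans (⟦⊖⟧ p (suc m)) (+-comm _ _)
    ⟦+⟧ -[1+ m ] -[1+ p ] = begin
      - ⟦ suc (suc (m ℕ.+ p)) ⟧ℕ      ≡⟨ cong (λ z → - ⟦ suc z ⟧ℕ) (ℕ.+-suc m p) ⟨
      - ⟦ suc m ℕ.+ suc p ⟧ℕ          ≡⟨ cong -_ (⟦+⟧ℕ (suc m) (suc p)) ⟩
      - (⟦ suc m ⟧ℕ + ⟦ suc p ⟧ℕ)     ≡⟨ -‿+-comm ⟦ suc m ⟧ℕ ⟦ suc p ⟧ℕ ⟨
      - ⟦ suc m ⟧ℕ - ⟦ suc p ⟧ℕ       ∎

    ⟦*⟧⁺ : ∀ m c → ⟦ pos m ℤ.* c ⟧ℤ ≡ ⟦ m ⟧ℕ * ⟦ c ⟧ℤ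
    ⟦*⟧⁺ m (pos p)    = trans (cong ⟦_⟧ℤ (sym (ℤ.pos-* m p))) (⟦*⟧ℕ m p)
    ⟦*⟧⁺ m -[1+ p ] = begin
      ⟦ pos m ℤ.* -[1+ p ] ⟧ℤ          ≡⟨ cong ⟦_⟧ℤ (ℤ.neg-distribʳ-* (pos m) (pos (suc p))) ⟨
      ⟦ ℤ.- (pos m ℤ.* pos (suc p)) ⟧ℤ     ≡⟨ ⟦-⟧ (pos m ℤ.* pos (suc p)) ⟩
      - ⟦ pos m ℤ.* pos (suc p) ⟧ℤ         ≡⟨ cong -_ (⟦*⟧⁺ m (pos (suc p))) ⟩
      - (⟦ m ⟧ℕ * ⟦ suc p ⟧ℕ)        ≡⟨ -‿distribʳ-* _ _ ⟩
      ⟦ m ⟧ℕ * - ⟦ suc p ⟧ℕ          ∎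

    ⟦*⟧ : ∀ a c → ⟦ a ℤ.* c ⟧ℤ ≡ ⟦ a ⟧ℤ * ⟦ c ⟧ℤ
    ⟦*⟧ (pos m)    c = ⟦*⟧⁺ m c
    ⟦*⟧ -[1+ m ] c = begin
      ⟦ -[1+ m ] ℤ.* c ⟧ℤ            ≡⟨ cong ⟦_⟧ℤ (ℤ.neg-distribˡ-* (pos (suc m)) c) ⟨
      ⟦ ℤ.- (pos (suc m) ℤ.* c) ⟧ℤ       ≡⟨ ⟦-⟧ (pos (suc m) ℤ.* c) ⟩
      - ⟦ pos (suc m) ℤ.* c ⟧ℤ           ≡⟨ cong -_ (⟦*⟧⁺ (suc m) c) ⟩
      - (⟦ suc m ⟧ℕ * ⟦ c ⟧ℤ)        ≡⟨ -‿distribˡ-* _ _ ⟩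
      - ⟦ suc m ⟧ℕ * ⟦ c ⟧ℤ          ∎

    ⟦⟧-homomorphism : ℤ-rawRing ACR.-Raw-AlmostCommutative⟶ ACR.fromCommutativeRing commutativeRing
    ⟦⟧-homomorphism = record
      { ⟦_⟧ = ⟦_⟧ℤ ; +-homo = ⟦+⟧ ; *-homo = ⟦*⟧ ; -‿homo = ⟦-⟧ ; 0-homo = refl ; 1-homo = refl }

    ⟦⟧-≟ : ∀ a c → Maybe (⟦ a ⟧ℤ ≡ ⟦ c ⟧ℤ)
    ⟦⟧-≟ a c with a ℤ.≟ c
    ... | yes a≡c = just (cong ⟦_⟧ℤ a≡c)
    ... | no _    = nothing

    open Algebra.Solver.Ring ℤ-rawRing (ACR.fromCommutativeRing commutativeRing) ⟦⟧-homomorphism ⟦⟧-≟ public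
      using (Polynomial; con; solve; _:=_; _:+_; _:*_; _:-_; :-_)

    -- Its value is definitionally equal to fromℕ m.
    :fromℕ : ∀ {p} → ℕ → Polynomial p
    :fromℕ zero    = con (pos 0)
    :fromℕ (suc m) = con (pos 1) :+ :fromℕ m

  open Solver public using (solve; _:=_; _:+_; _:*_; _:-_; :-_; con; :fromℕ)

  -- Most estimates below take this form: a known inequality, or a sum of several, is transported
  -- along a ring identity between differences, which the solver checks.
  ≤-by-difference : {a c x y : ℝ} → y - x ≡ c - a → a ≤ c → x ≤ y
  ≤-by-difference {a} {c} {x} {y} eq a≤c =
    subst₂ _≤_ (solve 2 (λ a x → a :+ (x :- a) := x) refl a x)
               (trans (solve 3 (λ a c x → c :+ (x :- a) := (c :- a) :+ x) refl a c x)
                      (trans (cong (_+ x) (sym eq)) (solve 2 (λ x y → y :- x :+ x := y) refl x y)))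
               (+-monoˡ-≤ (x - a) a≤c)

  ≤⇒0≤- : {x y : ℝ} → x ≤ y → 0# ≤ y - x
  ≤⇒0≤- {x} {y} = ≤-by-difference (solve 2 (λ x y → y :- x :- con (pos 0) := y :- x) refl x y)

  0≤-⇒≤ : {x y : ℝ} → 0# ≤ y - x → x ≤ y
  0≤-⇒≤ {x} {y} = ≤-by-difference (solve 2 (λ x y → y :- x := y :- x :- con (pos 0)) refl x y)

  +-mono-≤ : {a c x y : ℝ} → a ≤ c → x ≤ y → a + x ≤ c + y
  +-mono-≤ {a} {c} {x} {y} a≤c x≤y =
    ≤-trans (+-monoˡ-≤ x a≤c) (≤-by-difference (solve 3 (λ c x y → c :+ y :- (c :+ x) := y :- x) refl c x y) x≤y)

  *-monoˡ-≤ : {c x y : ℝ} → 0# ≤ c → x ≤ y → c * x ≤ c * y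
  *-monoˡ-≤ {c} {x} {y} 0≤c x≤y = ≤-by-difference
    (solve 3 (λ c x y → c :* y :- c :* x := c :* (y :- x) :- con (pos 0)) refl c x y)
    (*-nonNeg 0≤c (≤⇒0≤- x≤y))

  *-monoʳ-≤ : {c x y : ℝ} → 0# ≤ c → x ≤ y → x * c ≤ y * c
  *-monoʳ-≤ {c} {x} {y} 0≤c x≤y = subst₂ _≤_ (*-comm c x) (*-comm c y) (*-monoˡ-≤ 0≤c x≤y)

  <⇒≤ : {x y : ℝ} → x < y → x ≤ y
  <⇒≤ = proj₁

  <⇒≱ : {x y : ℝ} → x < y → ¬ y ≤ x
  <⇒≱ (x≤y , x≢y) y≤x = x≢y (≤-antisym x≤y y≤x)

  ≰⇒> : {x y : ℝ} → ¬ x ≤ y → y < x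
  ≰⇒> {x} {y} x≰y with ≤-total x y
  ... | inj₁ x≤y = ⊥-elim (x≰y x≤y)
  ... | inj₂ y≤x = y≤x , λ { refl → x≰y ≤-refl }

  ≰⇒≥ : {x y : ℝ} → ¬ x ≤ y → y ≤ x
  ≰⇒≥ = <⇒≤ ∘ ≰⇒>

  <-≤-trans : {x y z : ℝ} → x < y → y ≤ z → x < z
  <-≤-trans x<y y≤z = ≤-trans (<⇒≤ x<y) y≤z , λ { refl → <⇒≱ x<y y≤z }

  -- Otherwise `0# ≤ - 1#`, and the square of `- 1#` is `1#`.
  0≤1 : 0# ≤ 1#
  0≤1 with 0# ≤? 1#
  ... | yes p = p
  ... | no ¬p = ⊥-elim (¬p (subst (0# ≤_) (solve 0 ((:- con (pos 1)) :* (:- con (pos 1)) := con (pos 1)) refl)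
                                 (*-nonNeg 0≤-1 0≤-1)))
    where
    0≤-1 : 0# ≤ - 1#
    0≤-1 = ≤-by-difference (solve 0 (:- con (pos 1) :- con (pos 0) := con (pos 0) :- con (pos 1)) refl) (≰⇒≥ ¬p)

  ⁻¹-inverseˡ : {x : ℝ} → 0# < x → x ⁻¹ * x ≡ 1#
  ⁻¹-inverseˡ (_ , 0≢x) = trans (*-comm _ _) (⁻¹-inverse (0≢x ∘ sym))

  x/y*y≡x : {x y : ℝ} → y ≢ 0# → x / y * y ≡ x
  x/y*y≡x {x} {y} y≢0 =
    trans (*-assoc x _ y) (trans (cong (x *_) (trans (*-comm _ _) (⁻¹-inverse y≢0))) (*-identityʳ x))

  x/y*y≡x⁺ : {x y : ℝ} → 0# < y → x / y * y ≡ x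
  x/y*y≡x⁺ (_ , 0≢y) = x/y*y≡x (0≢y ∘ sym)

  *-pos : {x y : ℝ} → 0# < x → 0# < y → 0# < x * y
  *-pos {x} {y} 0<x 0<y = *-nonNeg (<⇒≤ 0<x) (<⇒≤ 0<y) , λ 0≡xy → proj₂ 0<y (begin
    0#               ≡⟨ zeroˡ _ ⟨
    0# * x ⁻¹        ≡⟨ cong (_* x ⁻¹) 0≡xy ⟩
    x * y * x ⁻¹     ≡⟨ solve 3 (λ x y z → x :* y :* z := z :* x :* y) refl x y (x ⁻¹) ⟩
    x ⁻¹ * x * y     ≡⟨ cong (_* y) (⁻¹-inverseˡ 0<x) ⟩
    1# * y           ≡⟨ *-identityˡ y ⟩
    y                ∎)
    where open ≡-Reasoning

  -- A negative inverse, multiplied by `x`, would give `1# ≤ 0#`; a zero inverse would give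
  -- `0# ≡ 1#`.
  ⁻¹-pos : {x : ℝ} → 0# < x → 0# < x ⁻¹
  ⁻¹-pos {x} 0<x = 0≤x⁻¹ , λ 0≡x⁻¹ → 0≢1 (trans (sym (zeroˡ x)) (trans (cong (_* x) 0≡x⁻¹) (⁻¹-inverseˡ 0<x)))
    where
    0≤x⁻¹ : 0# ≤ x ⁻¹
    0≤x⁻¹ with 0# ≤? x ⁻¹
    ... | yes p = p
    ... | no ¬p = ⊥-elim (0≢1 (≤-antisym 0≤1
      (subst₂ _≤_ (⁻¹-inverseˡ 0<x) (zeroˡ x) (*-monoʳ-≤ (<⇒≤ 0<x) (≰⇒≥ ¬p)))))

  *-cancelˡ-≤ : {c x y : ℝ} → 0# < c → c * x ≤ c * y → x ≤ y
  *-cancelˡ-≤ {c} {x} {y} 0<c cx≤cy =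
    subst₂ _≤_ (cancel x) (cancel y) (*-monoˡ-≤ (<⇒≤ (⁻¹-pos 0<c)) cx≤cy)
    where
    cancel : (z : ℝ) → c ⁻¹ * (c * z) ≡ z
    cancel z = trans (sym (*-assoc _ _ z)) (trans (cong (_* z) (⁻¹-inverseˡ 0<c)) (*-identityˡ z))

  *-cancelˡ-≡ : {c x y : ℝ} → 0# < c → c * x ≡ c * y → x ≡ y
  *-cancelˡ-≡ 0<c eq =
    ≤-antisym (*-cancelˡ-≤ 0<c (≤-reflexive eq)) (*-cancelˡ-≤ 0<c (≤-reflexive (sym eq)))

  0<x+y : {x y : ℝ} → 0# < x → 0# ≤ y → 0# < x + y
  0<x+y {x} {y} 0<x 0≤y = <-≤-trans 0<x
    (≤-by-difference (solve 2 (λ x y → x :+ y :- x := y :- con (pos 0)) refl x y) 0≤y)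

  0<- : {x y : ℝ} → x < y → 0# < y - x
  0<- {x} {y} (x≤y , x≢y) = ≤⇒0≤- x≤y , λ 0≡y-x → x≢y (begin
    x            ≡⟨ solve 1 (λ x → x := con (pos 0) :+ x) refl x ⟩
    0# + x       ≡⟨ cong (_+ x) 0≡y-x ⟩
    y - x + x    ≡⟨ solve 2 (λ x y → y :- x :+ x := y) refl x y ⟩
    y            ∎)
    where open ≡-Reasoning

  fromℕ-nonNeg : ∀ m → 0# ≤ fromℕ m
  fromℕ-nonNeg zero    = ≤-refl
  fromℕ-nonNeg (suc m) = subst (_≤ fromℕ (suc m)) (+-identityˡ 0#) (+-mono-≤ 0≤1 (fromℕ-nonNeg m))

  fromℕ-pos : ∀ m → 0# < fromℕ (suc m)
  fromℕ-pos m = 0<x+y (0≤1 , 0≢1) (fromℕ-nonNeg m)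

  fromℕ-mono : {m p : ℕ} → m ℕ.≤ p → fromℕ m ≤ fromℕ p
  fromℕ-mono {p = p} ℕ.z≤n = fromℕ-nonNeg p
  fromℕ-mono (ℕ.s≤s m≤p)   = +-mono-≤ ≤-refl (fromℕ-mono m≤p)

  -- If `p` were below `m`, the numeral of `m` would exceed that of `p` by at least one, and the
  -- hypothesis would give `1# ≤ 0#`.
  fromℕ-cancel-≤ : {m p : ℕ} → fromℕ m ≤ fromℕ p → m ℕ.≤ p
  fromℕ-cancel-≤ {m} {p} m≤p = ℕ.≮⇒≥ λ p<m → <⇒≱ (0≤1 , 0≢1)
    (≤-by-difference (solve 1 (λ p → con (pos 0) :- con (pos 1) := p :- (con (pos 1) :+ p)) refl (fromℕ p))
                     (≤-trans (fromℕ-mono p<m) m≤p))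

  fromℕ-+ : (m p : ℕ) → fromℕ (m ℕ.+ p) ≡ fromℕ m + fromℕ p
  fromℕ-+ = ×-homo-+ 1#

  fromℕ-* : (m p : ℕ) → fromℕ (m ℕ.* p) ≡ fromℕ m * fromℕ p
  fromℕ-* = ×1-homo-*

  ^-pos : {x : ℝ} → 0# < x → (m : ℕ) → 0# < x ^ m
  ^-pos 0<x zero    = 0≤1 , 0≢1
  ^-pos 0<x (suc m) = *-pos 0<x (^-pos 0<x m)

  ln-1 : ln 1# ≡ 0#
  ln-1 = begin
    ln 1#                      ≡⟨ solve 1 (λ x → x := x :+ x :- x) refl (ln 1#) ⟩
    ln 1# + ln 1# - ln 1#      ≡⟨ cong (_- ln 1#) (ln-* (0≤1 , 0≢1) (0≤1 , 0≢1)) ⟨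
    ln (1# * 1#) - ln 1#       ≡⟨ cong (λ z → ln z - ln 1#) (*-identityˡ 1#) ⟩
    ln 1# - ln 1#              ≡⟨ -‿inverseʳ _ ⟩
    0#                         ∎
    where open ≡-Reasoning

  ln-^ : {x : ℝ} → 0# < x → (m : ℕ) → ln (x ^ m) ≡ fromℕ m * ln x
  ln-^ 0<x zero    = trans ln-1 (sym (zeroˡ _))
  ln-^ {x} 0<x (suc m) = begin
    ln (x * x ^ m)           ≡⟨ ln-* 0<x (^-pos 0<x m) ⟩
    ln x + ln (x ^ m)        ≡⟨ cong (ln x +_) (ln-^ 0<x m) ⟩
    ln x + fromℕ m * ln x    ≡⟨ solve 2 (λ y z → y :+ z :* y := (con (pos 1) :+ z) :* y) refl (ln x) (fromℕ m) ⟩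
    (1# + fromℕ m) * ln x    ∎
    where open ≡-Reasoning

  -- The difference `ln x - ln y` is `ln (x / y)`, which is at most `x / y - 1#` and hence at most
  -- `0#`.
  ln-mono : {x y : ℝ} → 0# < x → x ≤ y → ln x ≤ ln y
  ln-mono {x} {y} 0<x x≤y = subst (λ z → ln z ≤ ln y) (x/y*y≡x⁺ 0<y)
    (≤-trans (≤-reflexive (ln-* 0<x/y 0<y))
      (≤-by-difference (solve 2 (λ u v → v :- (u :+ v) := con (pos 0) :- u) refl (ln (x / y)) (ln y))
        (≤-trans (ln≤x-1 0<x/y)
          (≤-by-difference (solve 1 (λ z → con (pos 0) :- (z :- con (pos 1)) := con (pos 1) :- z) refl (x / y)) x/y≤1))))
    where
    0<y : 0# < y
    0<y = <-≤-trans 0<x x≤y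
    0<x/y : 0# < x / y
    0<x/y = *-pos 0<x (⁻¹-pos 0<y)
    x/y≤1 : x / y ≤ 1#
    x/y≤1 = subst (x / y ≤_) (trans (*-comm y _) (⁻¹-inverseˡ 0<y)) (*-monoʳ-≤ (<⇒≤ (⁻¹-pos 0<y)) x≤y)

-- k-sets as partial colourings.

module Colourings where

  ∈⋃⁺ : ∀ {n} {x : Fin n} {p : Subset n} {ps} → p ∈ᴸ ps → x ∈ p → x ∈ ⋃ ps
  ∈⋃⁺ (here refl) x∈p = x∈p∪q⁺ (inj₁ x∈p)
  ∈⋃⁺ (there p∈)  x∈p = x∈p∪q⁺ (inj₂ (∈⋃⁺ p∈ x∈p))

  ∈⋃⁻ : ∀ {n} {x : Fin n} (ps : List (Subset n)) → x ∈ ⋃ ps → ∃ λ p → p ∈ᴸ ps × x ∈ p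
  ∈⋃⁻ []       x∈ = contradiction x∈ ∉⊥
  ∈⋃⁻ (p ∷ ps) x∈ with x∈p∪q⁻ p (⋃ ps) x∈
  ... | inj₁ x∈p = p , here refl , x∈p
  ... | inj₂ x∈⋃ with ∈⋃⁻ ps x∈⋃
  ...   | q , q∈ , x∈q = q , there q∈ , x∈q

  x∈p─q⇒x∉q : ∀ {n} {x : Fin n} (p q : Subset n) → x ∈ (p ─ q) → x ∉ q
  x∈p─q⇒x∉q (_ ∷ p) (_ ∷ q) (Vec.there x∈) (Vec.there x∈q) = x∈p─q⇒x∉q p q x∈ x∈q

  Colouring : ℕ → ℕ → Set
  Colouring n k = Fin n → Maybe (Fin k)

  module _ {k : ℕ} where

    infix 4 _≟ᶜ_
    _≟ᶜ_ : (a b : Maybe (Fin k)) → Dec (a ≡ b)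
    _≟ᶜ_ = ≡-dec Fin._≟_

    -- The effect of `⊓` and `⊔` at a single element. Both erase an element to which the arguments
    -- give different colours; only `join` keeps one that is coloured on a single side.
    meet join : Maybe (Fin k) → Maybe (Fin k) → Maybe (Fin k)
    meet (just i) (just j) = if ⌊ i Fin.≟ j ⌋ then just i else nothing
    meet _        _        = nothing
    join (just i) (just j) = if ⌊ i Fin.≟ j ⌋ then just i else nothing
    join (just i) nothing  = just i
    join nothing  b        = b

    meet-idem : ∀ a → meet a a ≡ a
    meet-idem nothing  = refl
    meet-idem (just i) with i Fin.≟ i
    ... | yes _  = refl
    ... | no i≢i = contradiction refl i≢i

    join-idem : ∀ a → join a a ≡ a
    join-idem nothing  = refl
    join-idem (just i) with i Fin.≟ i
    ... | yes _  = refl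
    ... | no i≢i = contradiction refl i≢i

    meet-≢ : ∀ {i j} → i ≢ j → meet (just i) (just j) ≡ nothing
    meet-≢ {i} {j} i≢j with i Fin.≟ j
    ... | yes i≡j = contradiction i≡j i≢j
    ... | no _    = refl

    join-≢ : ∀ {i j} → i ≢ j → join (just i) (just j) ≡ nothing
    join-≢ {i} {j} i≢j with i Fin.≟ j
    ... | yes i≡j = contradiction i≡j i≢j
    ... | no _    = refl

    join-identityʳ : ∀ a → join a nothing ≡ a
    join-identityʳ nothing  = refl
    join-identityʳ (just _) = refl

  module _ {n k : ℕ} where

    -- The parts agree by antisymmetry of inclusion, and since the disjointness proof is irrelevant
    -- this already identifies the k-sets.
    ⊑-antisym : {s t : KSet n k} → s ⊑ t → t ⊑ s → s ≡ t
    ⊑-antisym {s@(kset p _)} {t@(kset q _)} s⊑t t⊑s = helper p≡q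
      where
      p≡q : p ≡ q
      p≡q = trans (sym (tabulate∘lookup p))
              (trans (tabulate-cong (λ i → ⊆-antisym (s⊑t i) (t⊑s i))) (tabulate∘lookup q))
      helper : p ≡ q → s ≡ t
      helper refl = refl

    colourClass : Colouring n k → Fin k → Subset n
    colourClass f i = tabulate λ x → does (f x ≟ᶜ just i)

    ∈colourClass⁺ : ∀ f {x i} → f x ≡ just i → x ∈ colourClass f i
    ∈colourClass⁺ f {x} {i} fx≡i = lookup⇒[]= x _
      (trans (lookup∘tabulate _ x) (dec-true (f x ≟ᶜ just i) fx≡i))

    ∈colourClass⁻ : ∀ f {x i} → x ∈ colourClass f i → f x ≡ just i
    ∈colourClass⁻ f {x} {i} x∈ with f x ≟ᶜ just i | trans (sym (lookup∘tabulate (λ x → does (f x ≟ᶜ just i)) x)) ([]=⇒lookup x∈)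
    ... | yes fx≡i | _ = fx≡i

    -- A k-set is a partial colouring of the ground set by k colours.
    fromColouring : Colouring n k → KSet n k
    fromColouring f = kset (tabulate (colourClass f)) λ {i} {j} i≢j (x , x∈) →
      let x∈i , x∈j = x∈p∩q⁻ _ _ x∈ in
      i≢j (just-injective (trans
        (sym (∈colourClass⁻ f (subst (x ∈_) (lookup∘tabulate (colourClass f) i) x∈i)))
        (∈colourClass⁻ f (subst (x ∈_) (lookup∘tabulate (colourClass f) j) x∈j))))

    ∈fromColouring⁺ : ∀ f {x i} → f x ≡ just i → x ∈ part (fromColouring f) i
    ∈fromColouring⁺ f {x} {i} = subst (x ∈_) (sym (lookup∘tabulate (colourClass f) i)) ∘ ∈colourClass⁺ f

    ∈fromColouring⁻ : ∀ f {x i} → x ∈ part (fromColouring f) i → f x ≡ just i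
    ∈fromColouring⁻ f {x} {i} = ∈colourClass⁻ f ∘ subst (x ∈_) (lookup∘tabulate (colourClass f) i)

    colour : KSet n k → Colouring n k
    colour s x with any? (λ i → x ∈? part s i)
    ... | yes (i , _) = just i
    ... | no _        = nothing

    -- The search in `colour` returns some class containing the element; disjointness of the parts
    -- makes that class unique.
    fromColouring-colour : ∀ s → fromColouring (colour s) ≡ s
    fromColouring-colour s = ⊑-antisym (λ i x∈ → to _ _ (∈fromColouring⁻ (colour s) x∈))
                                       (λ i x∈ → ∈fromColouring⁺ (colour s) (from _ _ x∈))
      where
      to : ∀ x i → colour s x ≡ just i → x ∈ part s i
      to x i eq with any? (λ i → x ∈? part s i)
      to x i refl | yes (_ , x∈) = x∈
      from : ∀ x i → x ∈ part s i → colour s x ≡ just i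
      from x i x∈ with any? (λ i → x ∈? part s i)
      ... | no ∄ = contradiction (i , x∈) ∄
      ... | yes (j , x∈j) with j Fin.≟ i
      ...   | yes refl = refl
      ...   | no j≢i   = contradiction (x , x∈p∩q⁺ (x∈j , x∈)) (part-disjoint s j≢i)

    fromColouring-⊑ : ∀ f h → (∀ x {i} → f x ≡ just i → h x ≡ just i) → fromColouring f ⊑ fromColouring h
    fromColouring-⊑ f h f≼h i {x} x∈ = ∈fromColouring⁺ h (f≼h x (∈fromColouring⁻ f x∈))

    fromColouring-cong : ∀ {f h} → f ≗ h → fromColouring f ≡ fromColouring h
    fromColouring-cong {f} {h} f≗h = ⊑-antisym
      (fromColouring-⊑ f h λ x eq → trans (sym (f≗h x)) eq)
      (fromColouring-⊑ h f λ x eq → trans (f≗h x) eq)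

    ∈⊓⁺ : ∀ (s t : KSet n k) {x i} → x ∈ part s i → x ∈ part t i → x ∈ part (s ⊓ t) i
    ∈⊓⁺ s t {x} {i} x∈s x∈t = subst (x ∈_) (sym (lookup∘tabulate _ i)) (x∈p∩q⁺ (x∈s , x∈t))

    ∈⊓⁻ : ∀ (s t : KSet n k) {x i} → x ∈ part (s ⊓ t) i → x ∈ part s i × x ∈ part t i
    ∈⊓⁻ s t {x} {i} x∈ = x∈p∩q⁻ _ _ (subst (x ∈_) (lookup∘tabulate _ i) x∈)

    private
      u : KSet n k → KSet n k → Fin k → Subset n
      u s t i = part s i ∪ part t i

      others : KSet n k → KSet n k → Fin k → Subset n
      others s t i = ⋃ (List.map (u s t) (filter (λ j → ¬? (j Fin.≟ i)) (allFin k)))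

    ∈⊔⁺ : ∀ (s t : KSet n k) {x i} → x ∈ part s i ∪ part t i →
          (∀ {j} → j ≢ i → x ∉ part s j ∪ part t j) → x ∈ part (s ⊔ t) i
    ∈⊔⁺ s t {x} {i} x∈ x∉ = subst (x ∈_) (sym (lookup∘tabulate _ i)) (x∈p∧x∉q⇒x∈p─q x∈ x∉others)
      where
      x∉others : x ∉ others s t i
      x∉others x∈⋃ with ∈⋃⁻ (List.map (u s t) _) x∈⋃
      ... | _ , p∈ , x∈p with ∈-map⁻ (u s t) p∈
      ...   | j , j∈ , refl = x∉ (proj₂ (∈-filter⁻ (λ j → ¬? (j Fin.≟ i)) {xs = allFin k} j∈)) x∈p

    ∈⊔⁻ : ∀ (s t : KSet n k) {x i} → x ∈ part (s ⊔ t) i →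
          x ∈ part s i ∪ part t i × (∀ {j} → j ≢ i → x ∉ part s j ∪ part t j)
    ∈⊔⁻ s t {x} {i} x∈ = p─q⊆p _ _ x∈′ , λ {j} j≢i x∈uj → x∈p─q⇒x∉q (u s t i) (others s t i) x∈′
      (∈⋃⁺ (∈-map⁺ (u s t) (∈-filter⁺ (λ j → ¬? (j Fin.≟ i)) (∈-allFin j) j≢i)) x∈uj)
      where
      x∈′ : x ∈ u s t i ─ others s t i
      x∈′ = subst (x ∈_) (lookup∘tabulate _ i) x∈

    infixr 7 _⊓ᶜ_
    infixr 6 _⊔ᶜ_
    _⊓ᶜ_ _⊔ᶜ_ : Colouring n k → Colouring n k → Colouring n k
    (f ⊓ᶜ h) x = meet (f x) (h x)
    (f ⊔ᶜ h) x = join (f x) (h x)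

    fromColouring-⊓ : ∀ f h → fromColouring f ⊓ fromColouring h ≡ fromColouring (f ⊓ᶜ h)
    fromColouring-⊓ f h = ⊑-antisym
      (λ i {x} x∈ → let x∈f , x∈h = ∈⊓⁻ (fromColouring f) (fromColouring h) x∈ in
        ∈fromColouring⁺ (f ⊓ᶜ h) (trans (cong₂ meet (∈fromColouring⁻ f x∈f) (∈fromColouring⁻ h x∈h)) (meet-idem _)))
      (λ i {x} x∈ → let fx , hx = meet⁻ (f x) (h x) (∈fromColouring⁻ (f ⊓ᶜ h) x∈) in
        ∈⊓⁺ (fromColouring f) (fromColouring h) (∈fromColouring⁺ f fx) (∈fromColouring⁺ h hx))
      where
      meet⁻ : ∀ a b {i} → meet a b ≡ just i → a ≡ just i × b ≡ just i
      meet⁻ (just i) (just j) eq with i Fin.≟ j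
      meet⁻ (just i) (just j) refl | yes refl = refl , refl
      meet⁻ (just _) nothing ()

    fromColouring-⊔ : ∀ f h → fromColouring f ⊔ fromColouring h ≡ fromColouring (f ⊔ᶜ h)
    fromColouring-⊔ f h = ⊑-antisym
      (λ i {x} x∈ → ∈fromColouring⁺ (f ⊔ᶜ h) (to x i (∈⊔⁻ (fromColouring f) (fromColouring h) x∈)))
      (λ i {x} x∈ → from x i (∈fromColouring⁻ (f ⊔ᶜ h) x∈))
      where
      ∪⁻ : ∀ {x i} → x ∈ part (fromColouring f) i ∪ part (fromColouring h) i → f x ≡ just i ⊎ h x ≡ just i
      ∪⁻ {x} {i} x∈ with x∈p∪q⁻ (part (fromColouring f) i) (part (fromColouring h) i) x∈
      ... | inj₁ x∈f = inj₁ (∈fromColouring⁻ f x∈f)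
      ... | inj₂ x∈h = inj₂ (∈fromColouring⁻ h x∈h)

      ∪⁺ : ∀ {x i} → f x ≡ just i ⊎ h x ≡ just i → x ∈ part (fromColouring f) i ∪ part (fromColouring h) i
      ∪⁺ (inj₁ fx) = x∈p∪q⁺ (inj₁ (∈fromColouring⁺ f fx))
      ∪⁺ (inj₂ hx) = x∈p∪q⁺ (inj₂ (∈fromColouring⁺ h hx))

      to′ : ∀ a b {i} → a ≡ just i ⊎ b ≡ just i → (∀ {j} → j ≢ i → ¬ (a ≡ just j ⊎ b ≡ just j)) → join a b ≡ just i
      to′ nothing  b        (inj₂ b≡i)  _ = b≡i
      to′ (just i) nothing  (inj₁ refl) _ = refl
      to′ (just i) (just j) ∈ ∉ with i Fin.≟ j
      to′ (just i) (just _) (inj₁ refl) ∉ | yes refl = refl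
      to′ (just i) (just _) (inj₂ refl) ∉ | yes refl = refl
      to′ (just i) (just j) (inj₁ refl) ∉ | no i≢j   = contradiction (inj₂ refl) (∉ (i≢j ∘ sym))
      to′ (just i) (just j) (inj₂ refl) ∉ | no i≢j   = contradiction (inj₁ refl) (∉ i≢j)

      from′ : ∀ a b {i} → join a b ≡ just i → (a ≡ just i ⊎ b ≡ just i) × (∀ {j} → j ≢ i → ¬ (a ≡ just j ⊎ b ≡ just j))
      from′ nothing  (just i) refl = inj₂ refl , λ { j≢i (inj₂ refl) → j≢i refl }
      from′ (just i) nothing  refl = inj₁ refl , λ { j≢i (inj₁ refl) → j≢i refl }
      from′ (just i) (just j) eq with i Fin.≟ j
      from′ (just i) (just j) refl | yes refl =
        inj₁ refl , λ { j≢i (inj₁ refl) → j≢i refl ; j≢i (inj₂ refl) → j≢i refl }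

      to : ∀ x i → x ∈ part (fromColouring f) i ∪ part (fromColouring h) i ×
           (∀ {j} → j ≢ i → x ∉ part (fromColouring f) j ∪ part (fromColouring h) j) → join (f x) (h x) ≡ just i
      to x i (x∈ , x∉) = to′ (f x) (h x) (∪⁻ x∈) λ j≢i → x∉ j≢i ∘ ∪⁺

      from : ∀ x i → join (f x) (h x) ≡ just i → x ∈ part (fromColouring f ⊔ fromColouring h) i
      from x i eq = let ∈ , ∉ = from′ (f x) (h x) eq in
        ∈⊔⁺ (fromColouring f) (fromColouring h) (∪⁺ ∈) λ j≢i → ∉ j≢i ∘ ∪⁻

    infixl 5 _[_≔_]
    _[_≔_] : Colouring n k → Fin n → Maybe (Fin k) → Colouring n k
    (f [ x ≔ a ]) y = if ⌊ y Fin.≟ x ⌋ then a else f y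

    update-at : ∀ (f : Colouring n k) x {a} → (f [ x ≔ a ]) x ≡ a
    update-at f x with x Fin.≟ x
    ... | yes _  = refl
    ... | no x≢x = contradiction refl x≢x

    update-other : ∀ (f : Colouring n k) {x y a} → y ≢ x → (f [ x ≔ a ]) y ≡ f y
    update-other f {x} {y} y≢x with y Fin.≟ x
    ... | yes y≡x = contradiction y≡x y≢x
    ... | no _    = refl

    uncoloured : Colouring n k
    uncoloured _ = nothing

    𝟎≡ : 𝟎 ≡ fromColouring uncoloured
    𝟎≡ = ⊑-antisym (λ i {x} x∈ → contradiction (subst (x ∈_) (lookup∘tabulate _ i) x∈) ∉⊥)
                   (λ i x∈ → case ∈fromColouring⁻ uncoloured x∈ of λ ())

    single≡ : ∀ x i → single x i ≡ fromColouring (uncoloured [ x ≔ just i ])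
    single≡ x i = ⊑-antisym
      (λ j {y} y∈ → ∈fromColouring⁺ (uncoloured [ x ≔ just i ]) (to j y (subst (y ∈_) (lookup∘tabulate _ j) y∈)))
      (λ j {y} y∈ → subst (y ∈_) (sym (lookup∘tabulate _ j)) (from j y (∈fromColouring⁻ (uncoloured [ x ≔ just i ]) y∈)))
      where
      to : ∀ j y → y ∈ (if ⌊ j Fin.≟ i ⌋ then ⁅ x ⁆ else ∅) → (uncoloured [ x ≔ just i ]) y ≡ just j
      to j y y∈ with j Fin.≟ i
      ... | no _     = contradiction y∈ ∉⊥
      ... | yes refl with refl ← x∈⁅y⁆⇒x≡y x y∈ = update-at uncoloured x

      from : ∀ j y → (uncoloured [ x ≔ just i ]) y ≡ just j → y ∈ (if ⌊ j Fin.≟ i ⌋ then ⁅ x ⁆ else ∅)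
      from j y eq with y Fin.≟ x
      from j y refl | yes refl with i Fin.≟ i
      ... | yes _  = x∈⁅x⁆ x
      ... | no i≢i = contradiction refl i≢i

    -- With `x` uncoloured no colours conflict, so `⊔` erases nothing and acts as an update.
    extend≡ : ∀ f x i → f x ≡ nothing → fromColouring f ⊔ single x i ≡ fromColouring (f [ x ≔ just i ])
    extend≡ f x i fx≡∅ = trans (cong (fromColouring f ⊔_) (single≡ x i))
      (trans (fromColouring-⊔ f _) (fromColouring-cong pointwise))
      where
      pointwise : ∀ y → join (f y) ((uncoloured [ x ≔ just i ]) y) ≡ (f [ x ≔ just i ]) y
      pointwise y with y Fin.≟ x
      ... | yes refl rewrite fx≡∅ = refl
      ... | no _     = join-identityʳ (f y)

open Colourings

-- Weights of colourings.

module Weights ⦃ ℛ : RealField ⦄ {n k : ℕ} (w : Fin n → ℝ) (w-nonNeg : ∀ x → 0# ≤ w x) where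
  open Arithmetic
  open Algebra.Properties.CommutativeMonoid.Sum
    (CommutativeRing.+-commutativeMonoid commutativeRing) using (∑-comm; sum-cong-≗)

  sum-zero : ∀ {m} (a : Fin m → ℝ) → (∀ x → a x ≡ 0#) → sum a ≡ 0#
  sum-zero {zero}  a a≡0 = refl
  sum-zero {suc m} a a≡0 = trans (cong₂ _+_ (a≡0 zero) (sum-zero (a ∘ suc) (a≡0 ∘ suc))) (+-identityˡ 0#)

  sum-single : ∀ {m} (a : Fin m → ℝ) x → (∀ y → y ≢ x → a y ≡ 0#) → sum a ≡ a x
  sum-single {suc m} a zero    a≡0 =
    trans (cong (a zero +_) (sum-zero (a ∘ suc) λ y → a≡0 (suc y) λ ())) (+-identityʳ _)
  sum-single {suc m} a (suc x) a≡0 =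
    trans (cong₂ _+_ (a≡0 zero λ ()) (sum-single (a ∘ suc) x λ y y≢x → a≡0 (suc y) (y≢x ∘ Fin.suc-injective)))
          (+-identityˡ _)

  sum-update : ∀ {m} (a c : Fin m → ℝ) x {d : ℝ} → (∀ y → y ≢ x → c y ≡ a y) → c x ≡ a x + d → sum c ≡ sum a + d
  sum-update {suc m} a c zero {d} c≡a cx = trans
    (cong₂ _+_ cx (sum-cong-≗ λ y → c≡a (suc y) λ ()))
    (solve 3 (λ a s d → a :+ d :+ s := a :+ s :+ d) refl (a zero) (sum (a ∘ suc)) d)
  sum-update {suc m} a c (suc x) c≡a cx = trans
    (cong₂ _+_ (c≡a zero λ ()) (sum-update (a ∘ suc) (c ∘ suc) x (λ y y≢x → c≡a (suc y) (y≢x ∘ Fin.suc-injective)) cx))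
    (sym (+-assoc _ _ _))

  sum-mono : ∀ {m} (a c : Fin m → ℝ) → (∀ x → a x ≤ c x) → sum a ≤ sum c
  sum-mono {zero}  a c a≤c = ≤-refl
  sum-mono {suc m} a c a≤c = +-mono-≤ (a≤c zero) (sum-mono (a ∘ suc) (c ∘ suc) (a≤c ∘ suc))

  sum-const : ∀ m (c : ℝ) → sum {m} (λ _ → c) ≡ fromℕ m * c
  sum-const zero    c = sym (zeroˡ c)
  sum-const (suc m) c = trans (cong (c +_) (sum-const m c))
    (solve 2 (λ m c → c :+ m :* c := (con (pos 1) :+ m) :* c) refl (fromℕ m) c)

  sum-nonNeg : ∀ {m} (a : Fin m → ℝ) → (∀ x → 0# ≤ a x) → 0# ≤ sum a
  sum-nonNeg {m} a 0≤a = subst (_≤ sum a) (sum-zero {m} (const 0#) λ _ → refl) (sum-mono (const 0#) a 0≤a)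

  term≤sum : ∀ {m} (a : Fin m → ℝ) → (∀ x → 0# ≤ a x) → ∀ x → a x ≤ sum a
  term≤sum {suc m} a 0≤a zero    = subst (_≤ sum a) (+-identityʳ (a zero)) (+-mono-≤ ≤-refl (sum-nonNeg (a ∘ suc) (0≤a ∘ suc)))
  term≤sum {suc m} a 0≤a (suc x) =
    subst (_≤ sum a) (+-identityˡ (a (suc x))) (+-mono-≤ (0≤a zero) (term≤sum (a ∘ suc) (0≤a ∘ suc) x))

  cost : Fin n → Maybe (Fin k) → ℝ
  cost x nothing  = 0#
  cost x (just _) = w x

  cost-nonNeg : ∀ x a → 0# ≤ cost x a
  cost-nonNeg x nothing  = ≤-refl
  cost-nonNeg x (just _) = w-nonNeg x

  weightᶜ : Colouring n k → ℝ
  weightᶜ f = sum λ x → cost x (f x)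

  -- After the two sums are exchanged, the inner sum over colours has at most one nonzero term,
  -- because an element has at most one colour.
  weight-fromColouring : ∀ f → weight w (fromColouring f) ≡ weightᶜ f
  weight-fromColouring f = trans (∑-comm {k} {n} _) (sum-cong-≗ λ x → pointwise x (f x) refl)
    where
    a : Fin n → Fin k → ℝ
    a x i = if ⌊ x ∈? part (fromColouring f) i ⌋ then w x else 0#

    a-in : ∀ x i → f x ≡ just i → a x i ≡ w x
    a-in x i fx with x ∈? part (fromColouring f) i
    ... | yes _  = refl
    ... | no x∉ = contradiction (∈fromColouring⁺ f fx) x∉

    a-out : ∀ x i → f x ≢ just i → a x i ≡ 0#
    a-out x i fx with x ∈? part (fromColouring f) i
    ... | yes x∈ = contradiction (∈fromColouring⁻ f x∈) fx
    ... | no _   = refl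

    pointwise : ∀ x c → f x ≡ c → sum (a x) ≡ cost x c
    pointwise x nothing  fx = sum-zero (a x) λ i → a-out x i λ fx′ → case trans (sym fx) fx′ of λ ()
    pointwise x (just j) fx = trans
      (sum-single (a x) j λ i i≢j → a-out x i λ fx′ → i≢j (just-injective (trans (sym fx′) fx)))
      (a-in x j fx)

  weightᶜ-uncoloured : weightᶜ uncoloured ≡ 0#
  weightᶜ-uncoloured = sum-zero {n} (λ _ → 0#) λ _ → refl

  weightᶜ-update : ∀ f x i → f x ≡ nothing → weightᶜ (f [ x ≔ just i ]) ≡ weightᶜ f + w x
  weightᶜ-update f x i fx = sum-update (λ y → cost y (f y)) (λ y → cost y ((f [ x ≔ just i ]) y)) x
    (λ y y≢x → cong (cost y) (update-other f y≢x))
    (trans (cong (cost x) (update-at f x)) (trans (sym (+-identityˡ (w x))) (cong (λ c → cost x c + w x) (sym fx))))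

  w≤weightᶜ : ∀ f x {i} → f x ≡ just i → w x ≤ weightᶜ f
  w≤weightᶜ f x fx = subst (_≤ weightᶜ f) (cong (cost x) fx)
    (term≤sum (λ y → cost y (f y)) (λ y → cost-nonNeg y (f y)) x)

  weightᶜ≤n*max : ∀ f (M : ℝ) → 0# ≤ M → (∀ x → w x ≤ M) → weightᶜ f ≤ fromℕ n * M
  weightᶜ≤n*max f M 0≤M w≤M = subst (weightᶜ f ≤_) (sum-const n M) (sum-mono _ (λ _ → M) λ x → bound x (f x))
    where
    bound : ∀ x c → cost x c ≤ M
    bound x nothing  = 0≤M
    bound x (just _) = w≤M x

-- Diminishing returns, pairwise monotonicity and the greedy exchange.

module Submodular ⦃ ℛ : RealField ⦄ {n k : ℕ} (g : KSet n k → ℝ) (g-submodular : KSubmodular g) where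
  open Arithmetic

  G : Colouring n k → ℝ
  G f = g (fromColouring f)

  G-cong : ∀ {f h} → f ≗ h → G f ≡ G h
  G-cong = cong g ∘ fromColouring-cong

  -- Meet and join enter only up to pointwise equality, which avoids any appeal to function
  -- extensionality.
  submodularᶜ : ∀ {f h p q} → f ⊓ᶜ h ≗ p → f ⊔ᶜ h ≗ q → G p + G q ≤ G f + G h
  submodularᶜ {f} {h} {p} {q} ⊓≗p ⊔≗q =
    subst₂ (λ s t → g s + g t ≤ G f + G h)
      (trans (fromColouring-⊓ f h) (fromColouring-cong ⊓≗p))
      (trans (fromColouring-⊔ f h) (fromColouring-cong ⊔≗q))
      (g-submodular (fromColouring f) (fromColouring h))

  infix 4 _≼_
  -- The order `⊑` of k-sets, read on colourings.
  _≼_ : Colouring n k → Colouring n k → Set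
  f ≼ h = ∀ x → f x ≡ nothing ⊎ f x ≡ h x

  Δ : Colouring n k → Fin n → Fin k → ℝ
  Δ f x i = G (f [ x ≔ just i ]) - G f

  ≼-nothing : ∀ {f h} x → f ≼ h → h x ≡ nothing → f x ≡ nothing
  ≼-nothing x f≼h hx with f≼h x
  ... | inj₁ fx   = fx
  ... | inj₂ fx≡hx = trans fx≡hx hx

  -- Submodularity for `f [ x ≔ just i ]` and `h`: their meet is `f` and their join is
  -- `h [ x ≔ just i ]`.
  diminishing : ∀ {f h} x i → f ≼ h → h x ≡ nothing → Δ h x i ≤ Δ f x i
  diminishing {f} {h} x i f≼h hx = ≤-by-difference
    (solve 4 (λ f f′ h h′ → f′ :- f :- (h′ :- h) := f′ :+ h :- (f :+ h′)) refl
       (G f) (G (f [ x ≔ just i ])) (G h) (G (h [ x ≔ just i ])))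
    (submodularᶜ {f [ x ≔ just i ]} {h} {f} {h [ x ≔ just i ]} meet≗ join≗)
    where
    meet≗ : (f [ x ≔ just i ]) ⊓ᶜ h ≗ f
    meet≗ y with y Fin.≟ x
    ... | yes refl = trans (cong (meet (just i)) hx) (sym (≼-nothing {f} {h} x f≼h hx))
    ... | no _ with f≼h y
    ...   | inj₁ fy rewrite fy = refl
    ...   | inj₂ fy = trans (cong (meet (f y)) (sym fy)) (meet-idem (f y))

    join≗ : (f [ x ≔ just i ]) ⊔ᶜ h ≗ h [ x ≔ just i ]
    join≗ y with y Fin.≟ x
    ... | yes refl rewrite hx = refl
    ... | no _ with f≼h y
    ...   | inj₁ fy rewrite fy = refl
    ...   | inj₂ fy rewrite fy = join-idem (h y)

  -- The conflict at `x` is erased by both operations, so the meet and the join of the two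
  -- extensions are both `h`.
  pairwise-monotone : ∀ h x {i j} → i ≢ j → h x ≡ nothing → 0# ≤ Δ h x i + Δ h x j
  pairwise-monotone h x {i} {j} i≢j hx = ≤-by-difference
    (solve 3 (λ h a c → a :- h :+ (c :- h) :- con (pos 0) := a :+ c :- (h :+ h)) refl
       (G h) (G (h [ x ≔ just i ])) (G (h [ x ≔ just j ])))
    (submodularᶜ {h [ x ≔ just i ]} {h [ x ≔ just j ]} {h} {h} meet≗ join≗)
    where
    meet≗ : (h [ x ≔ just i ]) ⊓ᶜ (h [ x ≔ just j ]) ≗ h
    meet≗ y with y Fin.≟ x
    ... | yes refl = trans (meet-≢ i≢j) (sym hx)
    ... | no _     = meet-idem (h y)

    join≗ : (h [ x ≔ just i ]) ⊔ᶜ (h [ x ≔ just j ]) ≗ h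
    join≗ y with y Fin.≟ x
    ... | yes refl = trans (join-≢ i≢j) (sym hx)
    ... | no _     = join-idem (h y)

  Greedy : Colouring n k → Fin n → Fin k → Set
  Greedy f x i = ∀ j → Δ f x j ≤ Δ f x i

  -- How much of the value of a superset of f may be lost by giving x the greedy
  -- colour: nothing if g is monotone (b = 0), one marginal gain in general (b = 1).
  LossBound : ℕ → Set
  LossBound b = ∀ {f h} x i → f ≼ h → h x ≡ nothing → Greedy f x i →
    G h ≤ G (h [ x ≔ just i ]) + fromℕ b * Δ f x i

  lossBound-monotone : Monotone g → LossBound 0
  lossBound-monotone mono {f} {h} x i f≼h hx greedy =
    ≤-trans (mono _ _ (fromColouring-⊑ h _ λ y hy →
        trans (update-other h {x} {y} λ { refl → case trans (sym hx) hy of λ () }) hy))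
      (≤-reflexive (solve 2 (λ a d → a := a :+ con (pos 0) :* d) refl (G (h [ x ≔ just i ])) (Δ f x i)))

  other : 2 ℕ.≤ k → (i : Fin k) → ∃ λ j → i ≢ j
  other (ℕ.s≤s (ℕ.s≤s _)) zero    = suc zero , λ ()
  other (ℕ.s≤s (ℕ.s≤s _)) (suc i) = zero , λ ()

  -- Take a second colour `j`. By pairwise monotonicity the loss `- Δ h x i` is at most `Δ h x j`;
  -- this is at most `Δ f x j` by diminishing returns, and at most `Δ f x i` because `i` is greedy.
  lossBound : 2 ℕ.≤ k → LossBound 1
  lossBound 2≤k {f} {h} x i f≼h hx greedy with other 2≤k i
  ... | j , i≢j = ≤-by-difference
    (solve 4 (λ h a c d → a :+ (con (pos 1) :+ con (pos 0)) :* d :- h :=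
              (a :- h :+ (c :- h) :+ d) :- (con (pos 0) :+ (c :- h))) refl
       (G h) (G (h [ x ≔ just i ])) (G (h [ x ≔ just j ])) (Δ f x i))
    (+-mono-≤ (pairwise-monotone h x i≢j hx) (≤-trans (diminishing x j f≼h hx) (greedy j)))

  infixl 5 _▹_
  _▹_ : Colouring n k → Colouring n k → Colouring n k
  (f ▹ v) x = f x <∣> v x

  ≼▹ : ∀ f v → f ≼ f ▹ v
  ≼▹ f v x with f x
  ... | nothing = inj₁ refl
  ... | just _  = inj₂ refl

  -- Pass through the colouring `o′` in which `x` has no colour. Removing the colour that `v` gives
  -- to `x` costs at most one greedy gain by diminishing returns; inserting the greedy colour loses
  -- at most `b` gains by the loss bound.
  exchange : ∀ {b} → LossBound b → ∀ f v x i → f x ≡ nothing → Greedy f x i → 0# ≤ Δ f x i →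
             G (f ▹ v) ≤ G (f [ x ≔ just i ] ▹ v) + fromℕ (suc b) * Δ f x i
  exchange {b} loss f v x i fx greedy 0≤Δ = ≤-by-difference
    (solve 5 (λ o p q b d → q :+ (con (pos 1) :+ b) :* d :- o := (p :+ d :+ (q :+ b :* d)) :- (o :+ p)) refl
      (G o) (G o′) (G (f [ x ≔ just i ] ▹ v)) (fromℕ b) (Δ f x i))
    (+-mono-≤ removal insertion)
    where
    o o′ : Colouring n k
    o  = f ▹ v
    o′ = o [ x ≔ nothing ]

    o′x : o′ x ≡ nothing
    o′x = update-at o x

    f≼o′ : f ≼ o′
    f≼o′ y with y Fin.≟ x
    ... | yes refl = inj₁ fx
    ... | no _     = ≼▹ f v y

    removal : G o ≤ G o′ + Δ f x i
    removal = by-colour (o x) refl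
      where
      by-colour : ∀ a → o x ≡ a → G o ≤ G o′ + Δ f x i
      by-colour nothing  ox = subst (λ z → G o ≤ z + Δ f x i) (G-cong o≗o′)
        (≤-by-difference (solve 2 (λ o d → o :+ d :- o := d :- con (pos 0)) refl (G o) (Δ f x i)) 0≤Δ)
        where
        o≗o′ : o ≗ o′
        o≗o′ y with y Fin.≟ x
        ... | yes refl = ox
        ... | no _     = refl
      by-colour (just j) ox = subst (λ z → z ≤ G o′ + Δ f x i) (G-cong o′[x]≗o)
        (≤-by-difference (solve 3 (λ a c d → a :+ d :- c := d :- (c :- a)) refl
           (G o′) (G (o′ [ x ≔ just j ])) (Δ f x i)) (≤-trans (diminishing x j f≼o′ o′x) (greedy j)))
        where
        o′[x]≗o : o′ [ x ≔ just j ] ≗ o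
        o′[x]≗o y with y Fin.≟ x
        ... | yes refl = sym ox
        ... | no y≢x with y Fin.≟ x
        ...   | yes y≡x = contradiction y≡x y≢x
        ...   | no _    = refl

    insertion : G o′ ≤ G (f [ x ≔ just i ] ▹ v) + fromℕ b * Δ f x i
    insertion = subst (λ z → G o′ ≤ z + fromℕ b * Δ f x i) (G-cong same) (loss x i f≼o′ o′x greedy)
      where
      same : o′ [ x ≔ just i ] ≗ f [ x ≔ just i ] ▹ v
      same y with y Fin.≟ x
      ... | yes refl = refl
      ... | no y≢x with y Fin.≟ x
      ...   | yes y≡x = contradiction y≡x y≢x
      ...   | no _    = refl

  module _ (w : Fin n → ℝ) (w-nonNeg : ∀ x → 0# ≤ w x) (f v : Colouring n k) (θ : ℝ) (0≤θ : 0# ≤ θ)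
           (small : ∀ x i → f x ≡ nothing → v x ≡ just i → Δ f x i ≤ θ * w x) where
    open Weights {n = n} {k} w w-nonNeg

    private
      -- `h` is a stage on the way from `f` to `f ▹ v`, complete on the elements enumerated by `e`,
      -- and its gain so far is charged to their costs. An arbitrary enumeration `e` permits
      -- induction on `m`.
      Partial : ∀ {m} → (Fin m → Fin n) → Colouring n k → Set
      Partial e h = (∀ x → h x ≡ f x ⊎ h x ≡ (f ▹ v) x) × (∀ j → h (e j) ≡ (f ▹ v) (e j))
                  × G h ≤ G f + θ * sum (λ j → cost (e j) (v (e j)))

      fill : ∀ {m} (e : Fin m → Fin n) → ∃ (Partial e)
      fill {zero} e = f , (λ _ → inj₁ refl) , (λ ()) ,
        ≤-reflexive (solve 2 (λ f t → f := f :+ t :* con (pos 0)) refl (G f) θ)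
      fill {suc m} e with fill (e ∘ suc)
      ... | h , h-mixed , h-agrees , Gh≤ = by-colour (f x) (v x) refl refl
        where
        x : Fin n
        x = e zero
        S : ℝ
        S = sum λ j → cost (e (suc j)) (v (e (suc j)))

        bound : (z : ℝ) → z ≤ G h + θ * cost x (v x) → z ≤ G f + θ * (cost x (v x) + S)
        bound z z≤ = ≤-trans z≤ (≤-by-difference
          (solve 5 (λ f t c s h → f :+ t :* (c :+ s) :- (h :+ t :* c) := f :+ t :* s :- h) refl
            (G f) θ (cost x (v x)) S (G h)) Gh≤)

        keep : h x ≡ (f ▹ v) x → ∃ (Partial e)
        keep hx = h , h-mixed , (λ { zero → hx ; (suc j) → h-agrees j }) ,
          bound (G h) (≤-by-difference
            (solve 2 (λ h c → h :+ c :- h := c :- con (pos 0)) refl (G h) (θ * cost x (v x)))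
            (*-nonNeg 0≤θ (cost-nonNeg x (v x))))

        by-colour : ∀ a c → f x ≡ a → v x ≡ c → ∃ (Partial e)
        by-colour (just i) c fx vx = keep ([ (λ hx → trans hx (trans fx (cong (_<∣> v x) (sym fx)))) , id ]′ (h-mixed x))
        by-colour nothing nothing fx vx =
          keep ([ (λ hx → trans hx (trans (trans fx (sym vx)) (cong (_<∣> v x) (sym fx)))) , id ]′ (h-mixed x))
        by-colour nothing (just i) fx vx with h-mixed x
        -- `e` is not assumed injective, so `x` may already have its final colour.
        ... | inj₂ hx = keep hx
        ... | inj₁ hx = h [ x ≔ just i ] , mixed , agrees ,
          bound (G (h [ x ≔ just i ])) (≤-by-difference
            (solve 3 (λ h h′ c → h :+ c :- h′ := c :- (h′ :- h)) refl (G h) (G (h [ x ≔ just i ])) (θ * cost x (v x)))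
            -- The gain at the stage `h` is at most the gain at `f`, to which `small` applies.
            (≤-trans (diminishing x i f≼h (trans hx fx))
              (subst (λ c → Δ f x i ≤ θ * cost x c) (sym vx) (small x i fx vx))))
          where
          fx▹vx : just i ≡ (f ▹ v) x
          fx▹vx = trans (sym vx) (cong (_<∣> v x) (sym fx))
          f≼h : f ≼ h
          f≼h y with h-mixed y
          ... | inj₁ hy = inj₂ (sym hy)
          ... | inj₂ hy = [ inj₁ , (λ fy → inj₂ (trans fy (sym hy))) ]′ (≼▹ f v y)
          mixed : ∀ y → (h [ x ≔ just i ]) y ≡ f y ⊎ (h [ x ≔ just i ]) y ≡ (f ▹ v) y
          mixed y with y Fin.≟ x
          ... | yes refl = inj₂ fx▹vx
          ... | no _     = h-mixed y
          agrees : ∀ j → (h [ x ≔ just i ]) (e j) ≡ (f ▹ v) (e j)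
          agrees zero = trans (update-at h x) fx▹vx
          agrees (suc j) with e (suc j) Fin.≟ x
          ... | yes p = trans fx▹vx (cong (f ▹ v) (sym p))
          ... | no _  = h-agrees j

    completion-bound : G (f ▹ v) ≤ G f + θ * weightᶜ v
    completion-bound with fill id
    ... | h , _ , h≗ , Gh≤ = subst (_≤ G f + θ * weightᶜ v) (G-cong h≗) Gh≤

-- Executions of oracle programs: inversion and totality.

module Programs ⦃ ℛ : RealField ⦄ {Q : Set} (g : Q → ℝ) where
  open Arithmetic
  open Oracle Q

  >>=⁺ : ∀ {A B} {p : Prog A} {h : A → Prog B} {a b q₁ q₂} →
         g ⊢ p ⇓ a # q₁ → g ⊢ h a ⇓ b # q₂ → g ⊢ p >>= h ⇓ b # q₁ ℕ.+ q₂
  >>=⁺ return         h⇓ = h⇓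
  >>=⁺ (query p⇓)     h⇓ = query (>>=⁺ p⇓ h⇓)
  >>=⁺ (pick i ≤i p⇓) h⇓ = pick i ≤i (>>=⁺ p⇓ h⇓)

  >>=⁻ : ∀ {A B} (p : Prog A) {h : A → Prog B} {b q} → g ⊢ p >>= h ⇓ b # q →
         ∃ λ a → ∃ λ q₁ → ∃ λ q₂ → g ⊢ p ⇓ a # q₁ × g ⊢ h a ⇓ b # q₂ × q ≡ q₁ ℕ.+ q₂
  >>=⁻ (return a)  h⇓ = a , _ , _ , return , h⇓ , refl
  >>=⁻ (query s p) (query ⇓) with >>=⁻ (p (g s)) ⇓
  ... | a , _ , _ , p⇓ , h⇓ , refl = a , _ , _ , query p⇓ , h⇓ , refl
  >>=⁻ (pick f p)  (pick i ≤i ⇓) with >>=⁻ (p i) ⇓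
  ... | a , _ , _ , p⇓ , h⇓ , refl = a , _ , _ , pick i ≤i p⇓ , h⇓ , refl

  askAll⁻ : ∀ {m} (s : Fin m → Q) {vs q} → g ⊢ askAll s ⇓ vs # q →
            (∀ i → lookup vs i ≡ g (s i)) × q ≡ m
  askAll⁻ {zero}  s return = (λ ()) , refl
  askAll⁻ {suc m} s (query ⇓) with >>=⁻ (askAll (s ∘ suc)) ⇓
  ... | vs , _ , _ , ⇓vs , return , refl with askAll⁻ (s ∘ suc) ⇓vs
  ...   | lookup≡ , refl = (λ { zero → refl ; (suc i) → lookup≡ i }) , ℕ.+-identityʳ _

  Total : ∀ {A} → Prog A → Set
  Total p = ∃ λ a → ∃ λ q → g ⊢ p ⇓ a # q

  >>=-total : ∀ {A B} {p : Prog A} {h : A → Prog B} → Total p → (∀ a → Total (h a)) → Total (p >>= h)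
  >>=-total (a , _ , p⇓) h-total with h-total a
  ... | b , _ , h⇓ = b , _ , >>=⁺ p⇓ h⇓

  ask-total : ∀ s → Total (ask s)
  ask-total s = _ , _ , query return

  askAll-total : ∀ {m} (s : Fin m → Q) → Total (askAll s)
  askAll-total {zero}  s = _ , _ , return
  askAll-total {suc m} s = >>=-total (ask-total (s zero)) λ v →
    >>=-total (askAll-total (s ∘ suc)) λ vs → _ , _ , return

  maximiser : ∀ {m} (f : Fin (suc m) → ℝ) → ∃ λ i → ∀ j → f j ≤ f i
  maximiser {zero}  f = zero , λ { zero → ≤-refl }
  maximiser {suc m} f with maximiser (f ∘ suc)
  ... | i , ≤i with ≤-total (f zero) (f (suc i))
  ...   | inj₁ 0≤i = suc i , λ { zero → 0≤i ; (suc j) → ≤i j }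
  ...   | inj₂ i≤0 = zero , λ { zero → ≤-refl ; (suc j) → ≤-trans (≤i j) i≤0 }

  argmax-total : ∀ {m} (f : Fin (suc m) → ℝ) → Total (argmax f)
  argmax-total f with maximiser f
  ... | i , ≤i = i , _ , pick i ≤i return

  if-total : ∀ {A} c {p p′ : Prog A} → Total p → Total p′ → Total (if c then p else p′)
  if-total true  p⇓ p′⇓ = p⇓
  if-total false p⇓ p′⇓ = p′⇓

-- Serves to invert executions of branching programs: with `C` saying that a program has a given
-- execution, it yields the branch taken together with the outcome of the test.
if-∧ : ∀ {A : Set} {P Q : Set} (P? : Dec P) (Q? : Dec Q) {a b : A} (C : A → Set) →
       C (if ⌊ P? ⌋ ∧ ⌊ Q? ⌋ then a else b) → ((P × Q) × C a) ⊎ (¬ (P × Q) × C b)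
if-∧ (yes p) (yes q) C c = inj₁ ((p , q) , c)
if-∧ (yes p) (no ¬q) C c = inj₂ (¬q ∘ proj₂ , c)
if-∧ (no ¬p) Q?      C c = inj₂ (¬p ∘ proj₁ , c)

-- The possible steps of `Algorithm₁`.

module Algorithm₁Analysis ⦃ ℛ : RealField ⦄ {n k : ℕ} (2≤k : 2 ℕ.≤ k) (I : Instance n k)
    (ε : ℝ) (0<ε : 0# < ε) (ε<1 : ε < 1#) (mono : Bool) where
  open Arithmetic
  open Oracle (KSet n k)
  open Programs (g I)
  open Algorithms {n = n} {k} (w I) (τ I) ε mono
  open Instance I using (w-positive; g-nonNeg; g-𝟎; kSubmodular; τ-positive)
  open Submodular (g I) kSubmodular
  open Weights {n = n} {k} (w I) (λ x → <⇒≤ (w-positive x))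

  b : ℕ
  b = if mono then 0 else 1

  ρ : ℝ
  ρ = fromℕ (2 ℕ.+ b)

  1-ε≥0 : 0# ≤ 1# - ε
  1-ε≥0 = ≤⇒0≤- (<⇒≤ ε<1)

  ρε>0 : 0# < ρ * ε
  ρε>0 = *-pos (fromℕ-pos (suc b)) 0<ε

  module Steps (W : ℝ) where
    open Algorithm₁ W

    -- The mathematical content of one step, freed from the program. In `skip` the bound on
    -- singletons is conditional, since the reset test also fails for an element that is too heavy.
    data Outcome (x : Fin n) (s : KSet n k) : KSet n k → Set where
      reset  : ∀ i → w I x ≤ A → τ I ≤ g I (single x i) → Outcome x s (single x i)
      extend : ∀ i → (∀ j → g I (s ⊔ single x j) ≤ g I (s ⊔ single x i)) →
               θ ≤ (g I (s ⊔ single x i) - g I s) / w I x → weight (w I) s + w I x ≤ A →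
               Outcome x s (s ⊔ single x i)
      skip   : ∀ i → (w I x ≤ A → ∀ j → g I (single x j) ≤ τ I) →
               (∀ j → g I (s ⊔ single x j) ≤ g I (s ⊔ single x i)) →
               ¬ (θ ≤ (g I (s ⊔ single x i) - g I s) / w I x × weight (w I) s + w I x ≤ A) →
               Outcome x s s

    -- The else branch of `process` under a name of its own, definitionally the same program, so
    -- that its executions can be inverted separately.
    tryExtend : Fin n → KSet n k → Prog (KSet n k)
    tryExtend x s = do
      gs ← ask s
      extensions ← askAll (λ i → s ⊔ single x i)
      let Δ′ = λ i → lookup extensions i - gs
      i′ ← argmax Δ′
      if ⌊ θ ≤? Δ′ i′ / w I x ⌋ ∧ ⌊ weight (w I) s + w I x ≤? A ⌋
        then return (s ⊔ single x i′)
        else return s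

    tryExtend⁻ : ∀ x s {s′ q} → (w I x ≤ A → ∀ j → g I (single x j) ≤ τ I) →
                 g I ⊢ tryExtend x s ⇓ s′ # q → Outcome x s s′ × q ≡ suc k
    tryExtend⁻ x s {s′} small (query ⇓) with >>=⁻ (askAll (λ i → s ⊔ single x i)) ⇓
    ... | extensions , _ , q , ⇓ext , pick i ≤i ⇓′ , refl with askAll⁻ _ ⇓ext
    ... | ext≡ , refl = finish (if-∧ (θ ≤? (lookup extensions i - g I s) / w I x) (weight (w I) s + w I x ≤? A)
                                     (λ p → g I ⊢ p ⇓ s′ # q) ⇓′)
      where
      Accept : ℝ → Set
      Accept v = θ ≤ (v - g I s) / w I x × weight (w I) s + w I x ≤ A

      greedy : ∀ j → g I (s ⊔ single x j) ≤ g I (s ⊔ single x i)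
      greedy j = subst₂ _≤_ (ext≡ j) (ext≡ i)
        (≤-by-difference (solve 3 (λ a c s → c :- a := c :- s :- (a :- s)) refl
                            (lookup extensions j) (lookup extensions i) (g I s)) (≤i j))

      finish : (Accept (lookup extensions i) × g I ⊢ return (s ⊔ single x i) ⇓ s′ # q) ⊎
               (¬ Accept (lookup extensions i) × g I ⊢ return s ⇓ s′ # q) →
               Outcome x s s′ × suc (k ℕ.+ q) ≡ suc k
      finish (inj₁ (acc , return)) =
        (let θ≤ , ≤A = subst Accept (ext≡ i) acc in extend i greedy θ≤ ≤A) , cong suc (ℕ.+-identityʳ k)
      finish (inj₂ (¬acc , return)) =
        skip i small greedy (subst (¬_ ∘ Accept) (ext≡ i) ¬acc) , cong suc (ℕ.+-identityʳ k)

    process⁻ : ∀ x s {s′ q} → g I ⊢ process x s ⇓ s′ # q → Outcome x s s′ × q ℕ.≤ k ℕ.+ suc k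
    process⁻ x s {s′} ⇓ with >>=⁻ (askAll (λ i → single x i)) ⇓
    ... | singles , _ , q , ⇓singles , pick i ≤i ⇓′ , refl with askAll⁻ _ ⇓singles
    ... | singles≡ , refl = finish (if-∧ (w I x ≤? A) (τ I ≤? lookup singles i) (λ p → g I ⊢ p ⇓ s′ # q) ⇓′)
      where
      finish : ((w I x ≤ A × τ I ≤ lookup singles i) × g I ⊢ return (single x i) ⇓ s′ # q) ⊎
               (¬ (w I x ≤ A × τ I ≤ lookup singles i) × g I ⊢ tryExtend x s ⇓ s′ # q) →
               Outcome x s s′ × k ℕ.+ q ℕ.≤ k ℕ.+ suc k
      finish (inj₁ ((w≤A , τ≤) , return)) =
        reset i w≤A (subst (τ I ≤_) (singles≡ i) τ≤) , ℕ.+-monoʳ-≤ k ℕ.z≤n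
      finish (inj₂ (¬reset , ⇓″)) =
        let outcome , q≡ = tryExtend⁻ x s (λ w≤A j → subst (_≤ τ I) (singles≡ j)
                             (≤-trans (≤i j) (≰⇒≥ λ τ≤ → ¬reset (w≤A , τ≤)))) ⇓″
        in outcome , ℕ.+-monoʳ-≤ k (ℕ.≤-reflexive q≡)

    process-total : ∀ x s → Total (process x s)
    process-total x s = total 2≤k
      where
      total : 2 ℕ.≤ k → Total (process x s)
      -- The match exposes `k` as a successor, so that each `argmax` ranges over a nonempty family.
      total (ℕ.s≤s _) =
        >>=-total (askAll-total λ i → single x i) λ singles → >>=-total (argmax-total (lookup singles)) λ i →
        if-total (⌊ w I x ≤? A ⌋ ∧ ⌊ τ I ≤? lookup singles i ⌋) (single x i , _ , return) $
        >>=-total (ask-total s) λ gs → >>=-total (askAll-total λ i → s ⊔ single x i) λ exts →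
        >>=-total (argmax-total λ i → lookup exts i - gs) λ i′ →
        if-total (⌊ θ ≤? (lookup exts i′ - gs) / w I x ⌋ ∧ ⌊ weight (w I) s + w I x ≤? A ⌋)
          (s ⊔ single x i′ , _ , return) (s , _ , return)

  -- The charging invariant and the guarantee for one run.

  module Guarantee (loss : LossBound b) {W : ℝ} (0<W : 0# < W) where
    open Algorithm₁ W
    open Steps W

    -- `1# + ρ` computes to `fromℕ 3` or `fromℕ 4`, so one formula covers both budgets.
    A≡ : A ≡ (1# + ρ - ε) / (ρ * ε) * W
    A≡ = by-flag mono refl
      where
      by-flag : ∀ m → m ≡ mono → A ≡ (1# + ρ - ε) / (ρ * ε) * W
      by-flag true  refl = refl
      by-flag false refl = refl

    θ≥0 : 0# ≤ θ
    θ≥0 = <⇒≤ (*-pos (*-pos 0<ε τ-positive) (⁻¹-pos 0<W))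

    θW≡ετ : θ * W ≡ ε * τ I
    θW≡ετ = x/y*y≡x⁺ 0<W

    ρεA≡ : ρ * ε * A ≡ (1# + ρ - ε) * W
    ρεA≡ = begin
      ρ * ε * A                                 ≡⟨ cong (ρ * ε *_) A≡ ⟩
      ρ * ε * ((1# + ρ - ε) / (ρ * ε) * W)      ≡⟨ solve 3 (λ y q W → y :* (q :* W) :=
                q :* y :* W) refl (ρ * ε) ((1# + ρ - ε) / (ρ * ε)) W ⟩
      (1# + ρ - ε) / (ρ * ε) * (ρ * ε) * W      ≡⟨ cong (_* W) (x/y*y≡x⁺ ρε>0) ⟩
      (1# + ρ - ε) * W                          ∎
      where open ≡-Reasoning

    -- The difference `(1# + ρ - ε) - ρ * ε` factors as `(1# + ρ) * (1# - ε)`. Hence every element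
    -- of a solution of weight at most `W` fits the budget by itself.
    W≤A : W ≤ A
    W≤A = *-cancelˡ-≤ ρε>0 (subst (ρ * ε * W ≤_) (sym ρεA≡) (≤-by-difference
      (solve 3 (λ ρ ε W → (con (pos 1) :+ ρ :- ε) :* W :- ρ :* ε :* W :=
                (con (pos 1) :+ ρ) :* (con (pos 1) :- ε) :* W :- con (pos 0)) refl ρ ε W)
      (*-nonNeg (*-nonNeg (fromℕ-nonNeg (3 ℕ.+ b)) 1-ε≥0) (<⇒≤ 0<W))))

    -- The budget is tuned for this: multiplied by `ρ`, the estimate `θ * A ≤ G f + τ I` becomes
    -- `(1# - ε) * τ I ≤ ρ * G f`.
    ρθA≡ : ρ * (θ * A) ≡ (1# + ρ - ε) * τ I
    ρθA≡ = *-cancelˡ-≡ 0<ε (begin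
      ε * (ρ * (θ * A))              ≡⟨ solve 4 (λ ε ρ t A → ε :* (ρ :* (t :* A)) := t :* (ρ :* ε :* A)) refl ε ρ θ A ⟩
      θ * (ρ * ε * A)                ≡⟨ cong (θ *_) ρεA≡ ⟩
      θ * ((1# + ρ - ε) * W)         ≡⟨ solve 3 (λ t y W → t :* (y :* W) := y :* (t :* W)) refl θ (1# + ρ - ε) W ⟩
      (1# + ρ - ε) * (θ * W)         ≡⟨ cong ((1# + ρ - ε) *_) θW≡ετ ⟩
      (1# + ρ - ε) * (ε * τ I)       ≡⟨ solve 3 (λ y ε t → y :* (ε :* t) := ε :* (y :* t)) refl (1# + ρ - ε) ε (τ I) ⟩
      ε * ((1# + ρ - ε) * τ I)       ∎)
      where open ≡-Reasoning

    Good : Colouring n k → Set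
    Good f = (1# - ε) * τ I ≤ ρ * G f

    -- The charging invariant for a solution v: f ▹ v is v with the greedy choices
    -- of f overriding it, and rem is the rest of the stream.
    record Charged (f v : Colouring n k) (rem : List (Fin n)) : Set where
      field
        exchanged : G v ≤ G (f ▹ v) + fromℕ (suc b) * G f
        dense     : θ * weightᶜ f ≤ G f
        rejected  : ∀ x i → f x ≡ nothing → v x ≡ just i → x ∈ᴸ rem ⊎ Δ f x i ≤ θ * w I x
    open Charged

    -- A reset discards `f` together with its charges, and an element of `v` skipped for lack of
    -- budget cannot be charged. Both events establish `Good` instead, which all later steps
    -- preserve.
    record Invariant (rem : List (Fin n)) (s : KSet n k) : Set where
      field
        f         : Colouring n k
        s≡        : s ≡ fromColouring f
        fresh     : ∀ {x} → x ∈ᴸ rem → f x ≡ nothing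
        weight≤A  : weightᶜ f ≤ A
        guarantee : ∀ v → τ I ≤ G v → weightᶜ v ≤ W → Good f ⊎ Charged f v rem

    G-uncoloured : G uncoloured ≡ 0#
    G-uncoloured = trans (cong (g I) (sym 𝟎≡)) g-𝟎

    invariant-initial : ∀ {σ} → (∀ x → x ∈ᴸ σ) → Invariant σ 𝟎
    invariant-initial ∈σ = record
      { f         = uncoloured
      ; s≡        = 𝟎≡
      ; fresh     = λ _ → refl
      ; weight≤A  = subst (_≤ A) (sym weightᶜ-uncoloured) (≤-trans (<⇒≤ 0<W) W≤A)
      ; guarantee = λ v _ _ → inj₂ (record
        { exchanged = ≤-by-difference
            (solve 3 (λ v c u → v :+ c :* u :- v := c :* u :- con (pos 0)) refl (G v) (fromℕ (suc b)) (G uncoloured))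
            (*-nonNeg (fromℕ-nonNeg (suc b)) (g-nonNeg _))
        ; dense     = ≤-reflexive (trans (cong (θ *_) weightᶜ-uncoloured)
            (trans (solve 1 (λ t → t :* con (pos 0) := con (pos 0)) refl θ) (sym G-uncoloured)))
        ; rejected  = λ x _ _ _ → inj₁ (∈σ x) })
      }

    Good-mono : ∀ {f f′} → G f ≤ G f′ → Good f → Good f′
    Good-mono f≤f′ good = ≤-trans good (*-monoˡ-≤ (fromℕ-nonNeg (2 ℕ.+ b)) f≤f′)

    τ≤⇒Good : ∀ f → τ I ≤ G f → Good f
    τ≤⇒Good f τ≤ = ≤-trans
      (≤-by-difference (solve 3 (λ c ε t → (con (pos 1) :+ c) :* t :- (con (pos 1) :- ε) :* t :=
                c :* t :+ ε :* t :- (con (pos 0) :+ con (pos 0))) refl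
         (fromℕ (suc b)) ε (τ I))
        (+-mono-≤ (*-nonNeg (fromℕ-nonNeg (suc b)) (<⇒≤ τ-positive)) (*-nonNeg (<⇒≤ 0<ε) (<⇒≤ τ-positive))))
      (*-monoˡ-≤ (fromℕ-nonNeg (2 ℕ.+ b)) τ≤)

    -- Filling the budget at density `θ` gives `θ * A ≤ G f + Δ f x i`. The gain is at most the
    -- value of the singleton by diminishing returns, hence at most `τ I`, and `ρθA≡` concludes.
    over-budget⇒Good : ∀ f x i → f x ≡ nothing → G (uncoloured [ x ≔ just i ]) ≤ τ I → θ * weightᶜ f ≤ G f →
                       θ * w I x ≤ Δ f x i → A ≤ weightᶜ f + w I x → Good f
    over-budget⇒Good f x i fx single≤τ dense θw≤Δ A≤ = ≤-by-difference
      (solve 4 (λ ρ ε t u → ρ :* u :- (con (pos 1) :- ε) :* t :=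
                ρ :* (u :+ t) :- (con (pos 1) :+ ρ :- ε) :* t) refl ρ ε (τ I) (G f))
      (subst (_≤ ρ * (G f + τ I)) ρθA≡ (*-monoˡ-≤ (fromℕ-nonNeg (2 ℕ.+ b)) θA≤))
      where
      Δ≤τ : Δ f x i ≤ τ I
      Δ≤τ = ≤-trans (diminishing x i (λ _ → inj₁ refl) fx)
        (subst (λ z → G (uncoloured [ x ≔ just i ]) - z ≤ τ I) (sym G-uncoloured)
          (≤-by-difference (solve 2 (λ a t → t :- (a :- con (pos 0)) :=
                    t :- a) refl (G (uncoloured [ x ≔ just i ])) (τ I)) single≤τ))

      θA≤ : θ * A ≤ G f + τ I
      θA≤ = ≤-trans (*-monoˡ-≤ θ≥0 A≤)
        (≤-trans (≤-reflexive (distribˡ θ (weightᶜ f) (w I x))) (+-mono-≤ dense (≤-trans θw≤Δ Δ≤τ)))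

    invariant-step : ∀ {x xs s s′} → x ∉ᴸ xs → Invariant (x ∷ xs) s → Outcome x s s′ → Invariant xs s′
    invariant-step {x} {xs} x∉xs inv (reset i w≤A τ≤) = record
      { f         = uncoloured [ x ≔ just i ]
      ; s≡        = single≡ x i
      ; fresh     = λ {y} y∈ → update-other uncoloured {x} {y} {just i} λ { refl → x∉xs y∈ }
      ; weight≤A  = subst (_≤ A) (sym (trans (weightᶜ-update uncoloured x i refl)
                      (trans (cong (_+ w I x) weightᶜ-uncoloured) (+-identityˡ (w I x))))) w≤A
      ; guarantee = λ _ _ _ → inj₁ (τ≤⇒Good (uncoloured [ x ≔ just i ]) (subst (τ I ≤_) (cong (g I) (single≡ x i)) τ≤))
      }
    invariant-step {x} {xs} {s} x∉xs inv (extend i greedy′ θ≤′ ≤A) = record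
      { f         = f′
      ; s≡        = s′≡ i
      ; fresh     = λ {y} y∈ → trans (update-other f {x} {y} {just i} λ { refl → x∉xs y∈ }) (fresh (there y∈))
      ; weight≤A  = subst (_≤ A) (sym (weightᶜ-update f x i fx))
                      (subst (λ z → z + w I x ≤ A) (trans (cong (weight (w I)) s≡) (weight-fromColouring f)) ≤A)
      ; guarantee = λ v τ≤v v≤W → [ inj₁ ∘ Good-mono {f} {f′} Gf≤Gf′ , inj₂ ∘ charged v ]′ (guarantee v τ≤v v≤W)
      }
      where
      open Invariant inv
      f′ : Colouring n k
      f′ = f [ x ≔ just i ]

      fx : f x ≡ nothing
      fx = fresh (here refl)

      s′≡ : ∀ j → s ⊔ single x j ≡ fromColouring (f [ x ≔ just j ])
      s′≡ j = trans (cong (_⊔ single x j) s≡) (extend≡ f x j fx)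

      greedy : Greedy f x i
      greedy j = +-monoˡ-≤ (- G f) (subst₂ _≤_ (cong (g I) (s′≡ j)) (cong (g I) (s′≡ i)) (greedy′ j))

      θw≤Δ : θ * w I x ≤ Δ f x i
      θw≤Δ = subst (θ * w I x ≤_) (x/y*y≡x⁺ (w-positive x)) (*-monoʳ-≤ (<⇒≤ (w-positive x))
        (subst₂ (λ u v → θ ≤ (g I u - g I v) / w I x) (s′≡ i) s≡ θ≤′))

      0≤Δ : 0# ≤ Δ f x i
      0≤Δ = ≤-trans (*-nonNeg θ≥0 (<⇒≤ (w-positive x))) θw≤Δ

      Gf≤Gf′ : G f ≤ G f′
      Gf≤Gf′ = 0≤-⇒≤ 0≤Δ

      f≼f′ : f ≼ f′
      f≼f′ y with y Fin.≟ x
      ... | yes refl = inj₁ fx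
      ... | no _     = inj₂ refl

      charged : ∀ v → Charged f v (x ∷ xs) → Charged f′ v xs
      charged v c = record
        -- The charges telescope: the increase `G f′ - G f` is exactly the gain that pays for the
        -- exchange at `x`.
        { exchanged = ≤-by-difference
            (solve 6 (λ v o o′ c f f′ → o′ :+ c :* f′ :- v := (o :+ c :* f :+ (o′ :+ c :* (f′ :- f))) :- (v :+ o)) refl
              (G v) (G (f ▹ v)) (G (f′ ▹ v)) (fromℕ (suc b)) (G f) (G f′))
            (+-mono-≤ (exchanged c) (exchange {b} loss f v x i fx greedy 0≤Δ))
        ; dense     = subst (λ z → θ * z ≤ G f′) (sym (weightᶜ-update f x i fx)) (≤-by-difference
            (solve 5 (λ t u v f f′ → f′ :- t :* (u :+ v) :=
                      f :+ (f′ :- f) :- (t :* u :+ t :* v)) refl θ (weightᶜ f) (w I x) (G f) (G f′))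
            (+-mono-≤ (dense c) θw≤Δ))
        ; rejected  = rejected′
        }
        where
        rejected′ : ∀ y j → f′ y ≡ nothing → v y ≡ just j → y ∈ᴸ xs ⊎ Δ f′ y j ≤ θ * w I y
        rejected′ y j f′y vy with rejected c y j (≼-nothing {f} {f′} y f≼f′ f′y) vy
        ... | inj₁ (here refl) = case trans (sym (update-at f x)) f′y of λ ()
        ... | inj₁ (there y∈) = inj₁ y∈
        -- An earlier rejection stays valid, because gains can only shrink as `f` grows.
        ... | inj₂ Δ≤         = inj₂ (≤-trans (diminishing y j f≼f′ f′y) Δ≤)
    invariant-step {x} {xs} {s} x∉xs inv (skip i small′ greedy′ ¬accept) = record
      { f         = f
      ; s≡        = s≡
      ; fresh     = fresh ∘ there
      ; weight≤A  = weight≤A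
      ; guarantee = λ v τ≤v v≤W → [ inj₁ , charged v v≤W (v x) refl ]′ (guarantee v τ≤v v≤W)
      }
      where
      open Invariant inv
      fx : f x ≡ nothing
      fx = fresh (here refl)

      s′≡ : ∀ j → s ⊔ single x j ≡ fromColouring (f [ x ≔ just j ])
      s′≡ j = trans (cong (_⊔ single x j) s≡) (extend≡ f x j fx)

      greedy : Greedy f x i
      greedy j = +-monoˡ-≤ (- G f) (subst₂ _≤_ (cong (g I) (s′≡ j)) (cong (g I) (s′≡ i)) (greedy′ j))

      Δ/w*w : Δ f x i / w I x * w I x ≡ Δ f x i
      Δ/w*w = x/y*y≡x⁺ (w-positive x)

      w≤A : ∀ v → weightᶜ v ≤ W → ∀ {j} → v x ≡ just j → w I x ≤ A
      w≤A v v≤W vx = ≤-trans (w≤weightᶜ v x vx) (≤-trans v≤W W≤A)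

      shrink : ∀ v → (∀ j → v x ≡ just j → Δ f x j ≤ θ * w I x) → Charged f v (x ∷ xs) → Charged f v xs
      shrink v small c = record
        { exchanged = exchanged c
        ; dense     = dense c
        ; rejected  = λ y j fy vy → case rejected c y j fy vy of λ
            { (inj₁ (here refl)) → inj₂ (small j vy)
            ; (inj₁ (there y∈))  → inj₁ y∈
            ; (inj₂ Δ≤)          → inj₂ Δ≤ }
        }

      charged : ∀ v → weightᶜ v ≤ W → ∀ a → v x ≡ a → Charged f v (x ∷ xs) → Good f ⊎ Charged f v xs
      charged v v≤W nothing  vx c = inj₂ (shrink v (λ j vx′ → case trans (sym vx) vx′ of λ ()) c)
      charged v v≤W (just l) vx c with θ ≤? Δ f x i / w I x
      -- Rejected for density: the greedy gain also bounds the gain of the colour that `v` gives to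
      -- `x`.
      ... | no θ≰ = inj₂ (shrink v (λ j _ → ≤-trans (greedy j)
            (subst (_≤ θ * w I x) Δ/w*w (*-monoʳ-≤ (<⇒≤ (w-positive x)) (≰⇒≥ θ≰)))) c)
      -- Dense enough, so the budget caused the skip. As `v` contains `x`, the element fits `A` by
      -- itself, and the failed reset test bounds its singleton by `τ I`.
      ... | yes θ≤ = inj₁ (over-budget⇒Good f x i fx
            (subst (_≤ τ I) (cong (g I) (single≡ x i)) (small′ (w≤A v v≤W vx) i)) (dense c)
            (subst (θ * w I x ≤_) Δ/w*w (*-monoʳ-≤ (<⇒≤ (w-positive x)) θ≤))
            (≰⇒≥ λ ≤A → ¬accept
              ( subst₂ (λ u v → θ ≤ (g I u - g I v) / w I x) (sym (s′≡ i)) (sym s≡) θ≤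
              , subst (λ z → z + w I x ≤ A) (sym (trans (cong (weight (w I)) s≡) (weight-fromColouring f))) ≤A)))

    -- Chain `τ I ≤ G v ≤ G (f ▹ v) + fromℕ (suc b) * G f` with `G (f ▹ v) ≤ G f + θ * weightᶜ
    -- v` and `θ * weightᶜ v ≤ ε * τ I`; the coefficients of `G f` add up to `ρ`.
    Charged[]⇒Good : ∀ f v → τ I ≤ G v → weightᶜ v ≤ W → Charged f v [] → Good f
    Charged[]⇒Good f v τ≤v v≤W c = ≤-by-difference
      (solve 7 (λ ε t c f o v z → (con (pos 1) :+ c) :* f :- (con (pos 1) :- ε) :* t :=
                 (v :+ (o :+ c :* f) :+ (f :+ z) :+ ε :* t) :- (t :+ v :+ o :+ z)) refl
        ε (τ I) (fromℕ (suc b)) (G f) (G (f ▹ v)) (G v) (θ * weightᶜ v))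
      (+-mono-≤ (+-mono-≤ (+-mono-≤ τ≤v (exchanged c)) completed)
        (subst (θ * weightᶜ v ≤_) θW≡ετ (*-monoˡ-≤ θ≥0 v≤W)))
      where
      completed : G (f ▹ v) ≤ G f + θ * weightᶜ v
      completed = completion-bound (w I) (λ x → <⇒≤ (w-positive x)) f v θ θ≥0
        λ x i fx vx → [ (λ ()) , id ]′ (rejected c x i fx vx)

    invariant-final : ∀ {s} → Invariant [] s → weight (w I) s ≤ A ×
      (∀ v → τ I ≤ g I v → weight (w I) v ≤ W → (1# - ε) * τ I ≤ ρ * g I s)
    invariant-final {s} inv =
      subst (_≤ A) (sym (trans (cong (weight (w I)) s≡) (weight-fromColouring f))) weight≤A ,
      λ v τ≤v v≤W → let v≡ = fromColouring-colour v in
        subst (λ t → (1# - ε) * τ I ≤ ρ * g I t) (sym s≡)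
          (good (colour v) (subst (λ t → τ I ≤ g I t) (sym v≡) τ≤v)
            (subst (_≤ W) (trans (cong (weight (w I)) (sym v≡)) (weight-fromColouring (colour v))) v≤W))
      where
      open Invariant inv
      good : ∀ v → τ I ≤ G v → weightᶜ v ≤ W → Good f
      good v τ≤v v≤W = [ id , Charged[]⇒Good f v τ≤v v≤W ]′ (guarantee v τ≤v v≤W)

-- Totality and invariants of a pass over the stream.

module Streams ⦃ ℛ : RealField ⦄ {Q : Set} (g : Q → ℝ) where
  open Oracle Q
  open Programs g

  module _ {S X : Set} {stored : S → ℕ} {step : X → S → Prog S} where

    pass-total : (∀ x st → Total (step x st)) → ∀ st xs → ∃ λ st′ → ∃ λ m → ∃ λ q → Pass g stored step st xs st′ m q
    pass-total total st []       = _ , _ , _ , []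
    pass-total total st (x ∷ xs) with total x st
    ... | st′ , _ , ⇓ with pass-total total st′ xs
    ...   | _ , _ , _ , pass = _ , _ , _ , ⇓ ∷ pass

    -- The induction principle for passes; `P` relates the remaining stream to the state. The memory
    -- bound counts the current element and the states before and after it, each of size at most
    -- `M`.
    pass⁻ : (P : List X → S → Set) {M N : ℕ} → (∀ {xs st} → P xs st → stored st ℕ.≤ M) →
            (∀ {x xs st st′ q} → P (x ∷ xs) st → g ⊢ step x st ⇓ st′ # q → P xs st′ × q ℕ.≤ N) →
            ∀ {st xs st′ m q} → P xs st → Pass g stored step st xs st′ m q →
            P [] st′ × m ℕ.≤ 1 ℕ.+ (M ℕ.+ M) × q ℕ.≤ N
    pass⁻ P {M} stored≤M P-step p [] = p , ℕ.≤-trans (stored≤M p) (ℕ.≤-trans (ℕ.m≤m+n M M) (ℕ.n≤1+n _)) , ℕ.z≤n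
    pass⁻ P stored≤M P-step p (⇓ ∷ pass) with P-step p ⇓
    ... | p′ , q≤ with pass⁻ P stored≤M P-step p′ pass
    ...   | p″ , m≤ , q′≤ = p″ , ℕ.⊔-lub (ℕ.s≤s (ℕ.+-mono-≤ (stored≤M p) (stored≤M p′))) m≤ , ℕ.⊔-lub q≤ q′≤

-- `Algorithm₂`: the first pass and the final selection.

module Algorithm₂Analysis ⦃ ℛ : RealField ⦄ {n k : ℕ} (2≤k : 2 ℕ.≤ k) (I : Instance n k)
    (ε : ℝ) (0<ε : 0# < ε) (ε<1 : ε < 1#) (mono : Bool) where
  open Arithmetic
  open Oracle (KSet n k)
  open Programs (g I)
  open Streams (g I)
  open Algorithms {n = n} {k} (w I) (τ I) ε mono
  open Algorithm₂
  open Instance I using (w-positive; g-𝟎; kSubmodular; τ-positive; τ≤max)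
  open Submodular (g I) kSubmodular public using (LossBound; lossBound; lossBound-monotone)
  open Weights {n = n} {k} (w I) (λ x → <⇒≤ (w-positive x))
  open Algorithm₁Analysis 2≤k I ε 0<ε ε<1 mono

  open Min totalOrder using (⊓-sel; x⊓y≤x; x⊓y≤y)
  open Max totalOrder using (⊔-sel; x≤x⊔y; x≤y⊔x)

  0<1-ε : 0# < 1# - ε
  0<1-ε = 0<- ε<1

  r≡ρ : r ≡ ρ
  r≡ρ = by-flag mono refl
    where
    by-flag : ∀ m → m ≡ mono → r ≡ ρ
    by-flag true  refl = refl
    by-flag false refl = refl

  solution : ∃ λ v → τ I ≤ g I v
  solution = let _ , ((v , gv≡M) , _) , τ≤M = τ≤max in v , subst (τ I ≤_) (sym gv≡M) τ≤M

  -- `g` vanishes at `𝟎` whereas `τ I` is positive.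
  solution-nonempty : ∀ v → τ I ≤ g I v → ∃ λ x → ∃ λ i → colour v x ≡ just i
  solution-nonempty v τ≤ with Fin.all? (λ x → colour v x ≟ᶜ nothing)
  ... | yes empty = contradiction (subst (τ I ≤_) gv≡0 τ≤) (<⇒≱ τ-positive)
    where
    gv≡0 : g I v ≡ 0#
    gv≡0 = trans (cong (g I) (trans (sym (fromColouring-colour v)) (trans (fromColouring-cong empty) (sym 𝟎≡)))) g-𝟎
  ... | no ¬empty with ¬∀⟶∃¬ n _ (λ x → colour v x ≟ᶜ nothing) ¬empty
  ...   | x , coloured = by-colour (colour v x) refl
    where
    by-colour : ∀ a → colour v x ≡ a → ∃ λ x → ∃ λ i → colour v x ≡ just i
    by-colour nothing  vx = contradiction vx coloured
    by-colour (just i) vx = x , i , vx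

  weight-colour : ∀ v → weight (w I) v ≡ weightᶜ (colour v)
  weight-colour v = trans (cong (weight (w I)) (sym (fromColouring-colour v))) (weight-fromColouring (colour v))

  minimum-unique : {a c : ℝ} → IsMinimum (w I) a → IsMinimum (w I) c → a ≡ c
  minimum-unique {a} {c} ((x , wx) , a≤) ((y , wy) , c≤) =
    ≤-antisym (subst (a ≤_) wy (a≤ y)) (subst (c ≤_) wx (c≤ x))

  maximum-unique : {a c : ℝ} → IsMaximum (w I) a → IsMaximum (w I) c → a ≡ c
  maximum-unique {a} {c} ((x , wx) , ≤a) ((y , wy) , ≤c) =
    ≤-antisym (subst (_≤ c) wx (≤c x)) (subst (_≤ a) wy (≤a y))

  -- Every element is either still to come or already accounted for, so at the end of the stream the
  -- disjunctions collapse to genuine extrema.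
  Scanned : List (Fin n) → Extrema → Set
  Scanned xs nothing          = ∀ a → a ∈ᴸ xs
  Scanned xs (just (mn , mx)) = ((∃ λ a → w I a ≡ mn) × (∀ a → a ∈ᴸ xs ⊎ mn ≤ w I a))
                              × ((∃ λ a → w I a ≡ mx) × (∀ a → a ∈ᴸ xs ⊎ w I a ≤ mx))

  scan⁻ : ∀ {x xs e e′ q} → Scanned (x ∷ xs) e → g I ⊢ scan x e ⇓ e′ # q → Scanned xs e′ × q ℕ.≤ 0
  scan⁻ {x} {xs} {nothing} all∈ return =
    ( ((x , refl) , λ a → in-tail (λ { refl → ≤-refl }) (all∈ a))
    , ((x , refl) , λ a → in-tail (λ { refl → ≤-refl }) (all∈ a))) , ℕ.z≤n
    where
    in-tail : ∀ {a} {P : Set} → (a ≡ x → P) → a ∈ᴸ x ∷ xs → a ∈ᴸ xs ⊎ P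
    in-tail p (here a≡x) = inj₂ (p a≡x)
    in-tail p (there a∈) = inj₁ a∈
  scan⁻ {x} {xs} {just (mn , mx)} (((a , wa) , mn≤) , ((c , wc) , ≤mx)) return =
    ( ([ (λ eq → a , trans wa (sym eq)) , (λ eq → x , sym eq) ]′ (⊓-sel mn (w I x)) , λ y → min≤ (mn≤ y))
    , ([ (λ eq → c , trans wc (sym eq)) , (λ eq → x , sym eq) ]′ (⊔-sel mx (w I x)) , λ y → ≤max (≤mx y))) , ℕ.z≤n
    where
    min≤ : ∀ {y} → y ∈ᴸ x ∷ xs ⊎ mn ≤ w I y → y ∈ᴸ xs ⊎ min mn (w I x) ≤ w I y
    min≤ (inj₁ (here refl)) = inj₂ (x⊓y≤y mn (w I x))
    min≤ (inj₁ (there y∈))  = inj₁ y∈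
    min≤ (inj₂ mn≤wy)       = inj₂ (≤-trans (x⊓y≤x mn (w I x)) mn≤wy)
    ≤max : ∀ {y} → y ∈ᴸ x ∷ xs ⊎ w I y ≤ mx → y ∈ᴸ xs ⊎ w I y ≤ max mx (w I x)
    ≤max (inj₁ (here refl)) = inj₂ (x≤y⊔x mx (w I x))
    ≤max (inj₁ (there y∈))  = inj₁ y∈
    ≤max (inj₂ wy≤mx)       = inj₂ (≤-trans wy≤mx (x≤x⊔y mx (w I x)))

  storedExtrema≤2 : ∀ e → storedExtrema e ℕ.≤ 2
  storedExtrema≤2 nothing  = ℕ.z≤n
  storedExtrema≤2 (just _) = ℕ.≤-refl

  scan-total : ∀ x e → Total (scan x e)
  scan-total x nothing  = _ , _ , return
  scan-total x (just _) = _ , _ , return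

  storedRuns≤ : ∀ rs → storedRuns rs ℕ.≤ length rs ℕ.* n
  storedRuns≤ []             = ℕ.z≤n
  storedRuns≤ ((_ , s) ∷ rs) = ℕ.+-mono-≤ (∣p∣≤n (E s)) (storedRuns≤ rs)

  processAll-total : ∀ x rs → Total (processAll x rs)
  processAll-total x []             = _ , _ , return
  processAll-total x ((W , s) ∷ rs) = >>=-total (Steps.process-total W x s) λ s′ →
    >>=-total (processAll-total x rs) λ rs′ → _ , _ , return

  acceptable-total : ∀ rs → Total (acceptable rs)
  acceptable-total []             = _ , _ , return
  acceptable-total ((_ , s) ∷ rs) = >>=-total (ask-total s) λ gs →
    >>=-total (acceptable-total rs) λ H → _ , _ , return

  cheapest-total : ∀ H → Total (cheapest H)
  cheapest-total []         = _ , _ , return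
  cheapest-total H@(_ ∷ _) = >>=-total (argmax-total λ i → - weight (w I) (List.lookup H i)) λ i → _ , _ , return

  run-total : ∀ σ → ∃ λ out → ∃ λ m → ∃ λ q → Run (g I) σ out m q
  run-total σ with pass-total {stored = storedExtrema} {scan} scan-total nothing σ
  ... | e , _ , _ , pass₁ with pass-total {stored = storedRuns} {processAll} processAll-total (start e) σ
  ...   | rs , _ , _ , pass₂ with >>=-total (acceptable-total rs) cheapest-total
  ...     | out , _ , ⇓ = out , _ , _ , run pass₁ pass₂ ⇓

  Acceptable : KSet n k → Set
  Acceptable s = (1# - ε) * τ I / r ≤ g I s

  acceptable⁻ : ∀ rs {H q} → g I ⊢ acceptable rs ⇓ H # q →
    q ≡ length rs × (∀ {s} → s ∈ᴸ H → Acceptable s) × (∀ {W s} → (W , s) ∈ᴸ rs → Acceptable s → s ∈ᴸ H)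
  acceptable⁻ []             return = refl , (λ ()) , λ ()
  acceptable⁻ ((W , s) ∷ rs) (query ⇓) with >>=⁻ (acceptable rs) ⇓
  ... | H , q , _ , ⇓H , return , refl with acceptable⁻ rs ⇓H | (1# - ε) * τ I / r ≤? g I s
  ...   | refl , sound , complete | yes acc = cong suc (ℕ.+-identityʳ _) ,
          (λ { (here refl) → acc ; (there s∈) → sound s∈ }) ,
          (λ { (here refl) _ → here refl ; (there s∈) acc′ → there (complete s∈ acc′) })
  ...   | refl , sound , complete | no ¬acc = cong suc (ℕ.+-identityʳ _) , sound ,
          (λ { (here refl) acc → contradiction acc ¬acc ; (there s∈) acc′ → complete s∈ acc′ })

  -- Maximising the negated weight minimises the weight. The given member of `H` witnesses that `H`
  -- is nonempty, so that a solution is returned at all.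
  cheapest⁻ : ∀ H {out q} → g I ⊢ cheapest H ⇓ out # q → q ≡ 0 ×
    (∀ {s} → s ∈ᴸ H → ∃ λ x → out ≡ just x × x ∈ᴸ H × (∀ {t} → t ∈ᴸ H → weight (w I) x ≤ weight (w I) t))
  cheapest⁻ []         return = refl , λ ()
  cheapest⁻ H@(_ ∷ _) (pick i ≤i return) = refl , λ _ → List.lookup H i , refl , ∈-lookup i , λ t∈ →
    subst (λ t → weight (w I) (List.lookup H i) ≤ weight (w I) t) (sym (Any.lookup-index t∈))
      (≤-by-difference (solve 2 (λ a c → c :- a := :- a :- :- c) refl
         (weight (w I) (List.lookup H i)) (weight (w I) (List.lookup H (Any.index t∈)))) (≤i (Any.index t∈)))

  -- The geometric thresholds: their number, the resource bounds, and the one that fits a solution.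

  module _ (mn mx : ℝ) (mn-min : IsMinimum (w I) mn) (mx-max : IsMaximum (w I) mx) where

    γ l : ℝ
    γ = mn / mx
    l = ln (γ / fromℕ n) / ln (1# - ε)

    N : ℕ
    N = proj₁ (archimedean l)

    λ′ : ℕ → ℝ
    λ′ j = (1# - ε) ^ j * fromℕ n * mx

    0<mn : 0# < mn
    0<mn = let (a , wa) , _ = mn-min in subst (0# <_) wa (w-positive a)

    0<mx : 0# < mx
    0<mx = let (a , wa) , _ = mx-max in subst (0# <_) wa (w-positive a)

    0<n : 0# < fromℕ n
    0<n = positive (proj₁ (proj₁ mn-min))
      where
      positive : ∀ {m} → Fin m → 0# < fromℕ m
      positive {suc m} _ = fromℕ-pos m

    0<λ : ∀ j → 0# < λ′ j
    0<λ j = *-pos (*-pos (^-pos 0<1-ε j) 0<n) 0<mx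

    -- Induction on the range being filtered. If its last index passes the test, even the unfiltered
    -- range has at most `1# + l` entries; otherwise that index is dropped.
    thresholds-length : 0# ≤ l → fromℕ (length (thresholds mn mx)) ≤ 1# + l
    thresholds-length 0≤l = subst (λ m → fromℕ m ≤ 1# + l) (sym (length-map _ (filter P? (upTo (suc N))))) (bound (suc N))
      where
      P? : ∀ j → Dec (fromℕ j ≤ l)
      P? j = fromℕ j ≤? l
      bound : ∀ m → fromℕ (length (filter P? (upTo m))) ≤ 1# + l
      bound zero    = subst (_≤ 1# + l) (+-identityˡ 0#) (+-mono-≤ 0≤1 0≤l)
      bound (suc m) with fromℕ m ≤? l
      ... | yes m≤l = ≤-trans
        (fromℕ-mono (ℕ.≤-trans (length-filter P? (upTo (suc m))) (ℕ.≤-reflexive (length-upTo (suc m)))))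
        (+-mono-≤ ≤-refl m≤l)
      ... | no m≰l = subst (λ xs → fromℕ (length xs) ≤ 1# + l) (sym shrink) (bound m)
        where
        shrink : filter P? (upTo (suc m)) ≡ filter P? (upTo m)
        shrink = trans (cong (filter P?) (sym (upTo-∷ʳ m))) (trans (filter-++ P? (upTo m) (m ∷ []))
          (trans (cong (filter P? (upTo m) List.++_) (filter-reject P? m≰l)) (++-identityʳ _)))

    length≤2l : 1# ≤ l → fromℕ (length (thresholds mn mx)) ≤ fromℕ 2 * l
    length≤2l 1≤l = ≤-trans (thresholds-length (≤-trans 0≤1 1≤l))
      (≤-by-difference (solve 1 (λ l → :fromℕ 2 :* l :- (con (pos 1) :+ l) := l :- con (pos 1)) refl l) 1≤l)

    -- From `ℓ ≤ 2 * l` and `1 ≤ n * l`, the count `5 + 2 * ℓ * n` is at most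
    -- `5 * n * l + 4 * n * l`; this is the origin of the constant 9.
    memory-bound : 1# ≤ l → ∀ {m} → m ℕ.≤ 5 ℕ.+ 2 ℕ.* (length (thresholds mn mx) ℕ.* n) →
                   fromℕ m ≤ fromℕ 9 * (fromℕ n * l)
    memory-bound 1≤l m≤ = ≤-trans (fromℕ-mono m≤) (subst (_≤ fromℕ 9 * (fromℕ n * l))
      (sym (trans (fromℕ-+ 5 (2 ℕ.* (ℓ ℕ.* n)))
        (cong (fromℕ 5 +_) (trans (fromℕ-* 2 (ℓ ℕ.* n)) (cong (fromℕ 2 *_) (fromℕ-* ℓ n))))))
      (memory-arithmetic (fromℕ n) l (fromℕ ℓ) (fromℕ-nonNeg n) 1≤nl (length≤2l 1≤l)))
      where
      ℓ : ℕ
      ℓ = length (thresholds mn mx)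

      1≤n : ∀ {p} → Fin p → 1# ≤ fromℕ p
      1≤n {suc p} _ = subst (_≤ fromℕ (suc p)) (+-identityʳ 1#) (fromℕ-mono (ℕ.s≤s (ℕ.z≤n {p})))

      1≤nl : 1# ≤ fromℕ n * l
      1≤nl = ≤-trans (1≤n (proj₁ (proj₁ mn-min)))
        (subst (_≤ fromℕ n * l) (*-identityʳ (fromℕ n)) (*-monoˡ-≤ (fromℕ-nonNeg n) 1≤l))

      memory-arithmetic : (n l ℓ : ℝ) → 0# ≤ n → 1# ≤ n * l → ℓ ≤ fromℕ 2 * l →
                          fromℕ 5 + fromℕ 2 * (ℓ * n) ≤ fromℕ 9 * (n * l)
      memory-arithmetic n l ℓ 0≤n 1≤nl ℓ≤2l = ≤-by-difference
        (solve 3 (λ n l ℓ → :fromℕ 9 :* (n :* l) :- (:fromℕ 5 :+ :fromℕ 2 :* (ℓ :* n)) :=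
                    :fromℕ 5 :* (n :* l) :+ :fromℕ 2 :* n :* (:fromℕ 2 :* l) :-
                    (:fromℕ 5 :* con (pos 1) :+ :fromℕ 2 :* n :* ℓ)) refl n l ℓ)
        (+-mono-≤ (*-monoˡ-≤ (fromℕ-nonNeg 5) 1≤nl) (*-monoˡ-≤ (*-nonNeg (fromℕ-nonNeg 2) 0≤n) ℓ≤2l))

    -- `2 ≤ k` absorbs the part without `k`: the count is at most `2 * l * (2 + 2 * k)`, hence at
    -- most `6 * k * l`. A slack of `3 * k * l` is added to share the constant 9 with the memory
    -- bound.
    query-bound : 1# ≤ l → ∀ {q} → q ℕ.≤ length (thresholds mn mx) ℕ.* (2 ℕ.+ 2 ℕ.* k) →
                  fromℕ q ≤ fromℕ 9 * (fromℕ k * l)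
    query-bound 1≤l q≤ = ≤-trans (fromℕ-mono q≤) (subst (_≤ fromℕ 9 * (fromℕ k * l))
      (sym (trans (fromℕ-* ℓ (2 ℕ.+ 2 ℕ.* k))
        (cong (fromℕ ℓ *_) (trans (fromℕ-+ 2 (2 ℕ.* k)) (cong (fromℕ 2 +_) (fromℕ-* 2 k))))))
      (query-arithmetic (fromℕ k) l (fromℕ ℓ) (fromℕ-nonNeg k) (≤-trans 0≤1 1≤l) (fromℕ-mono 2≤k) (length≤2l 1≤l)))
      where
      ℓ : ℕ
      ℓ = length (thresholds mn mx)

      query-arithmetic : (k l ℓ : ℝ) → 0# ≤ k → 0# ≤ l → fromℕ 2 ≤ k → ℓ ≤ fromℕ 2 * l →
                         ℓ * (fromℕ 2 + fromℕ 2 * k) ≤ fromℕ 9 * (k * l)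
      query-arithmetic k l ℓ 0≤k 0≤l 2≤k ℓ≤2l = ≤-by-difference
        (solve 3 (λ k l ℓ → :fromℕ 9 :* (k :* l) :- ℓ :* (:fromℕ 2 :+ :fromℕ 2 :* k) :=
                    (:fromℕ 2 :+ :fromℕ 2 :* k) :* (:fromℕ 2 :* l) :+ (:fromℕ 2 :* l :* k :+ :fromℕ 3 :* k :* l) :-
                    ((:fromℕ 2 :+ :fromℕ 2 :* k) :* ℓ :+ (:fromℕ 2 :* l :* :fromℕ 2 :+ con (pos 0)))) refl k l ℓ)
        (+-mono-≤
          (*-monoˡ-≤ (subst (_≤ fromℕ 2 + fromℕ 2 * k) (+-identityˡ 0#)
            (+-mono-≤ (fromℕ-nonNeg 2) (*-nonNeg (fromℕ-nonNeg 2) 0≤k))) ℓ≤2l)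
          (+-mono-≤ (*-monoˡ-≤ (*-nonNeg (fromℕ-nonNeg 2) 0≤l) 2≤k)
                    (*-nonNeg (*-nonNeg (fromℕ-nonNeg 3) 0≤k) 0≤l)))

    thresholds-positive : All (0# <_) (thresholds mn mx)
    thresholds-positive = All.map⁺ (All.tabulate λ {j} _ → 0<λ j)

    -- Taking logarithms in γ / n ≤ (1 - ε)^j; ln (1 - ε) is negative.
    mn≤λ⇒j≤l : ∀ j → mn ≤ λ′ j → fromℕ j ≤ l
    mn≤λ⇒j≤l j mn≤λ = *-cancelˡ-≤ 0<-L (≤-by-difference
      (begin
        - L * l - - L * fromℕ j                      ≡⟨ solve 3 (λ L l j → (:- L) :* l :- (:- L) :* j :=
                  j :* L :- l :* L) refl L l (fromℕ j) ⟩
        fromℕ j * L - l * L                          ≡⟨ cong₂ _-_ (sym (ln-^ 0<1-ε j)) (x/y*y≡x L≢0) ⟩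
        ln ((1# - ε) ^ j) - ln (γ / fromℕ n)         ∎)
      (ln-mono 0<γ/n γ/n≤))
      where
      open ≡-Reasoning
      L : ℝ
      L = ln (1# - ε)
      0<-L : 0# < - L
      0<-L = <-≤-trans 0<ε (≤-by-difference
        (solve 2 (λ L ε → :- L :- ε := con (pos 1) :- ε :- con (pos 1) :- L) refl L ε) (ln≤x-1 0<1-ε))
      L≢0 : L ≢ 0#
      L≢0 L≡0 = proj₂ 0<-L (trans (sym -0#≈0#) (cong -_ (sym L≡0)))
      0<γ/n : 0# < γ / fromℕ n
      0<γ/n = *-pos (*-pos 0<mn (⁻¹-pos 0<mx)) (⁻¹-pos 0<n)
      γ/n≤ : γ / fromℕ n ≤ (1# - ε) ^ j
      γ/n≤ = *-cancelˡ-≤ (*-pos 0<n 0<mx) (subst₂ _≤_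
        (sym (begin
          fromℕ n * mx * (γ / fromℕ n)      ≡⟨ solve 3 (λ n m q → n :* m :* q :=
                    q :* n :* m) refl (fromℕ n) mx (γ / fromℕ n) ⟩
          γ / fromℕ n * fromℕ n * mx        ≡⟨ cong (_* mx) (x/y*y≡x⁺ 0<n) ⟩
          γ * mx                            ≡⟨ x/y*y≡x⁺ 0<mx ⟩
          mn                                ∎))
        (solve 3 (λ p n m → p :* n :* m := n :* m :* p) refl ((1# - ε) ^ j) (fromℕ n) mx)
        mn≤λ)

    -- Walk down the geometric sequence to the last threshold that is still at least the weight of
    -- `v`; the next one is smaller by the factor `1# - ε` and already falls below that weight.
    threshold-for : ∀ v → τ I ≤ g I v →
      ∃ λ W → W ∈ᴸ thresholds mn mx × weight (w I) v ≤ W × (1# - ε) * W ≤ weight (w I) v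
    -- The first argument of `search` is fuel. It cannot run out, because `V ≤ λ′ j` forces `j` to
    -- be at most `N`.
    threshold-for v τ≤ = search (suc N) 0 (ℕ.+-identityʳ (suc N)) V≤λ₀
      where
      V : ℝ
      V = weight (w I) v

      mn≤V : mn ≤ V
      mn≤V with solution-nonempty v τ≤
      ... | x , i , vx = ≤-trans (proj₂ mn-min x) (subst (w I x ≤_) (sym (weight-colour v)) (w≤weightᶜ (colour v) x vx))

      V≤λ₀ : V ≤ λ′ 0
      V≤λ₀ = subst₂ _≤_ (sym (weight-colour v)) (cong (_* mx) (sym (*-identityˡ (fromℕ n))))
        (weightᶜ≤n*max (colour v) mx (<⇒≤ 0<mx) (proj₂ mx-max))

      j≤l : ∀ j → V ≤ λ′ j → fromℕ j ≤ l
      j≤l j V≤ = mn≤λ⇒j≤l j (≤-trans mn≤V V≤)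

      j≤N : ∀ j → V ≤ λ′ j → j ℕ.≤ N
      j≤N j V≤ = fromℕ-cancel-≤ (≤-trans (j≤l j V≤) (proj₂ (archimedean l)))

      search : ∀ d j → d ℕ.+ j ≡ suc N → V ≤ λ′ j →
               ∃ λ W → W ∈ᴸ thresholds mn mx × V ≤ W × (1# - ε) * W ≤ V
      search zero    j refl V≤ = contradiction (j≤N j V≤) ℕ.1+n≰n
      search (suc d) j eq V≤ with V ≤? λ′ (suc j)
      ... | yes V≤′ = search d (suc j) (trans (ℕ.+-suc d j) eq) V≤′
      ... | no V≰ = λ′ j
          , ∈-map⁺ λ′ (∈-filter⁺ (λ j → fromℕ j ≤? l) (∈-upTo⁺ (ℕ.s≤s (j≤N j V≤))) (j≤l j V≤))
          , V≤
          , subst (_≤ V) (solve 4 (λ y p n m → y :* p :* n :* m :=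
                    y :* (p :* n :* m)) refl (1# - ε) ((1# - ε) ^ j) (fromℕ n) mx) (≰⇒≥ V≰)

  -- The parallel runs and the bicriteria guarantee.

  module _ (loss : LossBound b) where

    RunInvariant : List (Fin n) → ℝ × KSet n k → Set
    RunInvariant xs (W , s) = ∃ λ (0<W : 0# < W) → Guarantee.Invariant loss 0<W xs s

    processAll⁻ : ∀ {x xs} rs {rs′ q} → x ∉ᴸ xs → All (RunInvariant (x ∷ xs)) rs → g I ⊢ processAll x rs ⇓ rs′ # q →
      All (RunInvariant xs) rs′ × List.map proj₁ rs′ ≡ List.map proj₁ rs × q ℕ.≤ length rs ℕ.* (k ℕ.+ suc k)
    processAll⁻ [] x∉ [] return = [] , refl , ℕ.z≤n
    processAll⁻ {x} ((W , s) ∷ rs) x∉ ((0<W , inv) ∷ invs) ⇓ with >>=⁻ (Algorithm₁.process W x s) ⇓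
    ... | s′ , q , _ , ⇓s′ , ⇓′ , refl with >>=⁻ (processAll x rs) ⇓′
    ... | rs′ , _ , _ , ⇓rs′ , return , refl with processAll⁻ rs x∉ invs ⇓rs′ | Steps.process⁻ W x s ⇓s′
    ... | invs′ , Ws≡ , q′≤ | outcome , q≤ =
      (0<W , Guarantee.invariant-step loss 0<W x∉ inv outcome) ∷ invs′ , cong (W ∷_) Ws≡ ,
      ℕ.+-mono-≤ q≤ (ℕ.≤-trans (ℕ.≤-reflexive (ℕ.+-identityʳ _)) q′≤)

    X : ℝ
    X = 1# + ρ - ε

    -- For `ρ` equal to `fromℕ 2` or `fromℕ 3` this is definitionally the approximation factor
    -- claimed.
    α : ℝ
    α = X / (ρ * ε * (1# - ε))

    -- `A` equals `α * ((1# - ε) * W)`: the factor `1# - ε` in the denominator of `α` pays for the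
    -- gap between `W` and `V`.
    A≤αV : {W V : ℝ} → 0# < W → (1# - ε) * W ≤ V → Algorithm₁.A W ≤ α * V
    A≤αV {W} {V} 0<W ≤V = subst (_≤ α * V) (sym (begin
      Algorithm₁.A W                     ≡⟨ Guarantee.A≡ loss 0<W ⟩
      X / (ρ * ε) * W                    ≡⟨ cong (_* W) (*-cancelˡ-≡ ρε>0 quotient) ⟩
      α * (1# - ε) * W                   ≡⟨ *-assoc α (1# - ε) W ⟩
      α * ((1# - ε) * W)                 ∎))
      (*-monoˡ-≤ 0≤α ≤V)
      where
      open ≡-Reasoning
      Y>0 : 0# < ρ * ε * (1# - ε)
      Y>0 = *-pos ρε>0 0<1-ε
      0≤α : 0# ≤ α
      0≤α = *-nonNeg (≤-by-difference
        (solve 2 (λ ρ ε → con (pos 1) :+ ρ :- ε :- con (pos 0) :=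
                  con (pos 1) :- ε :+ ρ :- (con (pos 0) :+ con (pos 0))) refl ρ ε)
        (+-mono-≤ 1-ε≥0 (fromℕ-nonNeg (2 ℕ.+ b)))) (<⇒≤ (⁻¹-pos Y>0))
      quotient : ρ * ε * (X / (ρ * ε)) ≡ ρ * ε * (α * (1# - ε))
      quotient = begin
        ρ * ε * (X / (ρ * ε))           ≡⟨ *-comm (ρ * ε) (X / (ρ * ε)) ⟩
        X / (ρ * ε) * (ρ * ε)           ≡⟨ x/y*y≡x⁺ ρε>0 ⟩
        X                               ≡⟨ x/y*y≡x⁺ Y>0 ⟨
        α * (ρ * ε * (1# - ε))          ≡⟨ solve 3 (λ α y z → α :* (y :* z) := y :* (α :* z)) refl α (ρ * ε) (1# - ε) ⟩
        ρ * ε * (α * (1# - ε))          ∎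

    Good⇒Acceptable : ∀ s → (1# - ε) * τ I ≤ ρ * g I s → Acceptable s
    Good⇒Acceptable s good = *-cancelˡ-≤ (fromℕ-pos (suc b)) (subst (_≤ ρ * g I s)
      (sym (trans (cong (λ z → ρ * ((1# - ε) * τ I / z)) r≡ρ) (trans (*-comm ρ _) (x/y*y≡x⁺ (fromℕ-pos (suc b)))))) good)

    Acceptable⇒ : ∀ s → Acceptable s → (1# - ε) / ρ * τ I ≤ g I s
    Acceptable⇒ s = subst (_≤ g I s) (trans (cong (λ z → (1# - ε) * τ I / z) r≡ρ)
      (solve 3 (λ y t z → y :* t :* z := y :* z :* t) refl (1# - ε) (τ I) (ρ ⁻¹)))

    module _ {σ : List (Fin n)} (σ↭ : σ ↭ allFin n) where

      ∈σ : ∀ x → x ∈ᴸ σ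
      ∈σ x = ∈-resp-↭ (↭-sym σ↭) (∈-allFin x)

      σ-unique : Unique σ
      σ-unique = Permutation.Unique-resp-↭ (setoid (Fin n)) (↭⇒↭ₛ (↭-sym σ↭)) (allFin⁺ n)

      module _ (mn mx : ℝ) (mn-min : IsMinimum (w I) mn) (mx-max : IsMaximum (w I) mx) where

        T : List ℝ
        T = thresholds mn mx

        InvariantRuns : List (Fin n) → Runs → Set
        InvariantRuns xs rs = Unique xs × List.map proj₁ rs ≡ T × All (RunInvariant xs) rs

        length-runs : ∀ (rs : Runs) → List.map proj₁ rs ≡ T → length rs ≡ length T
        length-runs rs eq = trans (sym (length-map proj₁ rs)) (cong length eq)

        start-invariant : InvariantRuns σ (start (just (mn , mx)))
        start-invariant = σ-unique , trans (sym (map-∘ T)) (map-id T) ,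
          All.map⁺ (All.map (λ 0<W → 0<W , Guarantee.invariant-initial loss 0<W ∈σ) (thresholds-positive mn mx mn-min mx-max))

        processAll-step : ∀ {x xs rs rs′ q} → InvariantRuns (x ∷ xs) rs → g I ⊢ processAll x rs ⇓ rs′ # q →
                          InvariantRuns xs rs′ × q ℕ.≤ length T ℕ.* (k ℕ.+ suc k)
        processAll-step {x} {xs} {rs} {rs′} {q} (unique@(_ ∷ unique′) , Ws≡ , invs) ⇓ =
          let invs′ , Ws≡′ , q≤ = processAll⁻ rs (Unique[x∷xs]⇒x∉xs unique) invs ⇓
          in (unique′ , trans Ws≡′ Ws≡ , invs′) , subst (λ z → q ℕ.≤ z ℕ.* (k ℕ.+ suc k)) (length-runs rs Ws≡) q≤

        second-pass : ∀ {rs m q} → Pass (g I) storedRuns processAll (start (just (mn , mx))) σ rs m q →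
          InvariantRuns [] rs × m ℕ.≤ 1 ℕ.+ (length T ℕ.* n ℕ.+ length T ℕ.* n) × q ℕ.≤ length T ℕ.* (k ℕ.+ suc k)
        second-pass = pass⁻ InvariantRuns
          (λ {_} {rs} (_ , Ws≡ , _) → subst (λ z → storedRuns rs ℕ.≤ z ℕ.* n) (length-runs rs Ws≡) (storedRuns≤ rs))
          processAll-step start-invariant

        -- The run whose threshold `W` fits `v` is acceptable because `v` weighs at most `W`, and
        -- cheap because `(1# - ε) * W` is at most the weight of `v`.
        accepted-run : ∀ {rs} → InvariantRuns [] rs → ∀ v → τ I ≤ g I v →
          ∃ λ W → ∃ λ s → (W , s) ∈ᴸ rs × Acceptable s × weight (w I) s ≤ α * weight (w I) v
        accepted-run {rs} (_ , Ws≡ , invs) v τ≤ =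
          let W , W∈T , v≤W , ≤v = threshold-for mn mx mn-min mx-max v τ≤
              (W′ , s) , ∈rs , W≡W′ = ∈-map⁻ proj₁ (subst (W ∈ᴸ_) (sym Ws≡) W∈T)
              0<W , inv = All.lookup invs ∈rs
              s≤A , good = Guarantee.invariant-final loss 0<W inv
          in W′ , s , ∈rs , Good⇒Acceptable s (good v τ≤ (subst (weight (w I) v ≤_) W≡W′ v≤W))
            , ≤-trans s≤A (A≤αV 0<W (subst (λ z → (1# - ε) * z ≤ weight (w I) v) W≡W′ ≤v))

        finish⁻ : ∀ {rs out q} → InvariantRuns [] rs → g I ⊢ finish rs ⇓ out # q →
                  q ≡ length T × Bicriteria I α ((1# - ε) / ρ) out
        finish⁻ {rs} {out} inv@(_ , Ws≡ , _) ⇓ =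
          let H , q₁ , q₂ , ⇓H , ⇓out , q≡ = >>=⁻ (acceptable rs) ⇓
              q₁≡ , sound , complete = acceptable⁻ rs ⇓H
              q₂≡ , choose = cheapest⁻ H ⇓out
              -- Any solution shows that `H` is nonempty; the cost of the output is afterwards
              -- compared with the run that fits an optimal `v`.
              v₀ , τ≤v₀ = solution
              _ , _ , ∈rs₀ , acc₀ , _ = accepted-run inv v₀ τ≤v₀
              x , out≡ , x∈H , x≤ = choose (complete ∈rs₀ acc₀)
          in trans q≡ (trans (cong₂ ℕ._+_ q₁≡ q₂≡) (trans (ℕ.+-identityʳ (length rs)) (length-runs rs Ws≡)))
            , x , out≡
            , (λ v (τ≤v , _) → let _ , _ , ∈rs , acc , s≤ = accepted-run inv v τ≤v in ≤-trans (x≤ (complete ∈rs acc)) s≤)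
            , Acceptable⇒ x (sound x∈H)

      -- The summand 5 bounds the first pass: one element and two states of size at most 2. Of the
      -- `2 + 2 * k` queries per threshold, `2 * k + 1` belong to the stream and one to the final
      -- selection.
      record Result (out : Maybe (KSet n k)) (m q : ℕ) : Set where
        field
          mn mx       : ℝ
          mn-min      : IsMinimum (w I) mn
          mx-max      : IsMaximum (w I) mx
          bicriteria  : Bicriteria I α ((1# - ε) / ρ) out
          memory      : m ℕ.≤ 5 ℕ.+ 2 ℕ.* (length (thresholds mn mx) ℕ.* n)
          queries     : q ℕ.≤ length (thresholds mn mx) ℕ.* (2 ℕ.+ 2 ℕ.* k)

      run⁻ : ∀ {out m q} → Run (g I) σ out m q → Result out m q
      run⁻ {out} (run {e} {rs} {_} {m₁} {m₂} {q₁} {q₂} {q₃} pass₁ pass₂ ⇓) =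
        let scanned , m₁≤ , q₁≤ = pass⁻ Scanned (λ {_} {e} _ → storedExtrema≤2 e) scan⁻ ∈σ pass₁
        in by-extrema e scanned m₁≤ q₁≤ pass₂
        where
        by-extrema : ∀ e → Scanned [] e → m₁ ℕ.≤ 5 → q₁ ℕ.≤ 0 → Pass (g I) storedRuns processAll (start e) σ rs m₂ q₂ →
                     Result out (m₁ ℕ.⊔ m₂) (q₁ ℕ.+ q₂ ℕ.+ q₃)
        -- A first pass without extrema would mean an empty ground set, yet a solution contains an
        -- element.
        by-extrema nothing all∈[] _ _ _ =
          let v , τ≤ = solution in case all∈[] (proj₁ (solution-nonempty v τ≤)) of λ ()
        by-extrema (just (mn , mx)) ((a , mn≤) , (c , ≤mx)) m₁≤ q₁≤ pass₂ =
          let inv , m₂≤ , q₂≤ = second-pass mn mx mn-min mx-max pass₂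
              q₃≡ , bicriteria = finish⁻ mn mx mn-min mx-max inv ⇓
          in record
            { mn = mn ; mx = mx ; mn-min = mn-min ; mx-max = mx-max
            ; bicriteria = bicriteria
            ; memory = memory≤ (length (thresholds mn mx)) m₁≤ m₂≤
            ; queries = queries≤ (length (thresholds mn mx)) q₁≤ q₂≤ q₃≡ }
          where
          mn-min : IsMinimum (w I) mn
          mn-min = a , λ x → [ (λ ()) , id ]′ (mn≤ x)
          mx-max : IsMaximum (w I) mx
          mx-max = c , λ x → [ (λ ()) , id ]′ (≤mx x)

          memory≤ : ∀ ℓ → m₁ ℕ.≤ 5 → m₂ ℕ.≤ 1 ℕ.+ (ℓ ℕ.* n ℕ.+ ℓ ℕ.* n) → m₁ ℕ.⊔ m₂ ℕ.≤ 5 ℕ.+ 2 ℕ.* (ℓ ℕ.* n)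
          memory≤ ℓ m₁≤ m₂≤ = ℕ.⊔-lub (ℕ.≤-trans m₁≤ (ℕ.m≤m+n 5 _)) (ℕ.≤-trans m₂≤ (ℕ.≤-trans
            (ℕ.≤-reflexive (cong (λ z → suc (ℓ ℕ.* n ℕ.+ z)) (sym (ℕ.+-identityʳ (ℓ ℕ.* n)))))
            (ℕ.+-monoˡ-≤ (2 ℕ.* (ℓ ℕ.* n)) (ℕ.s≤s (ℕ.z≤n {4})))))

          queries≤ : ∀ ℓ → q₁ ℕ.≤ 0 → q₂ ℕ.≤ ℓ ℕ.* (k ℕ.+ suc k) → q₃ ≡ ℓ →
                     q₁ ℕ.+ q₂ ℕ.+ q₃ ℕ.≤ ℓ ℕ.* (2 ℕ.+ 2 ℕ.* k)
          queries≤ ℓ q₁≤ q₂≤ q₃≡ = ℕ.≤-trans (ℕ.+-mono-≤ (ℕ.+-mono-≤ q₁≤ q₂≤) (ℕ.≤-reflexive q₃≡))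
            (ℕ.≤-reflexive (trans (ℕ.+-comm (ℓ ℕ.* (k ℕ.+ suc k)) ℓ) (trans (sym (ℕ.*-suc ℓ (k ℕ.+ suc k)))
              (cong (λ z → ℓ ℕ.* suc z) (trans (ℕ.+-suc k k) (cong (λ z → suc (k ℕ.+ z)) (sym (ℕ.+-identityʳ k))))))))

      -- Extrema are unique, so the given ones, and `l′` with them, agree with those found by the
      -- first pass.
      resource-bounds : ∀ {out m q} → Run (g I) σ out m q → (w-min w-max γ′ l′ : ℝ) →
        IsMinimum (w I) w-min → IsMaximum (w I) w-max → γ′ ≡ w-min / w-max →
        l′ ≡ ln (γ′ / fromℕ n) / ln (1# - ε) → 1# ≤ l′ →
        fromℕ m ≤ fromℕ 9 * (fromℕ n * l′) × fromℕ q ≤ fromℕ 9 * (fromℕ k * l′)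
      resource-bounds {out} {m} {q} ⇓ w-min w-max _ l′ w-min-min w-max-max refl l′≡ 1≤l′ =
        subst (λ z → fromℕ m ≤ fromℕ 9 * (fromℕ n * z)) (sym l′≡l) (memory-bound mn mx mn-min mx-max 1≤l memory) ,
        subst (λ z → fromℕ q ≤ fromℕ 9 * (fromℕ k * z)) (sym l′≡l) (query-bound mn mx mn-min mx-max 1≤l queries)
        where
        open Result (run⁻ ⇓)
        l′≡l : l′ ≡ l mn mx mn-min mx-max
        l′≡l = trans l′≡ (cong₂ (λ a c → ln (a / c / fromℕ n) / ln (1# - ε))
          (minimum-unique w-min-min mn-min) (maximum-unique w-max-max mx-max))
        1≤l : 1# ≤ l mn mx mn-min mx-max
        1≤l = subst (1# ≤_) l′≡l 1≤l′

theorem3 :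
    ∃ λ (C : ℕ) →
    ⦃ ℛ : RealField ⦄ →
    (n k : ℕ) → 2 ℕ.≤ k →
    (ε : ℝ) → 0# < ε → ε < 1# →
    (I : Instance n k) →
    (monotone? : Dec (Monotone (g I))) →
    (σ : List (Fin n)) → σ ↭ allFin n →
    (∃ λ out → ∃ λ m → ∃ λ q → Algorithms.Algorithm₂.Run (w I) (τ I) ε ⌊ monotone? ⌋ (g I) σ out m q)
    × ((out : Maybe (KSet n k)) (m q : ℕ) → Algorithms.Algorithm₂.Run (w I) (τ I) ε ⌊ monotone? ⌋ (g I) σ out m q →
        (Monotone (g I) →
          Bicriteria I ((fromℕ 3 - ε) / (fromℕ 2 * ε * (1# - ε))) ((1# - ε) / fromℕ 2) out)
        × (¬ Monotone (g I) →
          Bicriteria I ((fromℕ 4 - ε) / (fromℕ 3 * ε * (1# - ε))) ((1# - ε) / fromℕ 3) out)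
        × ((w-min w-max γ l : ℝ) →
            IsMinimum (w I) w-min → IsMaximum (w I) w-max →
            γ ≡ w-min / w-max →
            l ≡ ln (γ / fromℕ n) / ln (1# - ε) →
            1# ≤ l →
            fromℕ m ≤ fromℕ C * (fromℕ n * l)
            × fromℕ q ≤ fromℕ C * (fromℕ k * l)))
-- Splitting on the decision fixes the flag, and with it `b`, `ρ` and `α`. Each case supplies its
-- own loss bound, and the guarantee for the opposite case holds by contradiction.
theorem3 = 9 , λ
  { n k 2≤k ε 0<ε ε<1 I (yes mono) σ σ↭ →
      let open Algorithm₂Analysis 2≤k I ε 0<ε ε<1 true
          loss = lossBound-monotone mono
      in run-total σ , λ out m q ⇓ →
           (λ _ → Result.bicriteria (run⁻ loss σ↭ ⇓)) , contradiction mono , resource-bounds loss σ↭ ⇓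
  ; n k 2≤k ε 0<ε ε<1 I (no ¬mono) σ σ↭ →
      let open Algorithm₂Analysis 2≤k I ε 0<ε ε<1 false
          loss = lossBound 2≤k
      in run-total σ , λ out m q ⇓ →
           (λ mono → contradiction mono ¬mono) , (λ _ → Result.bicriteria (run⁻ loss σ↭ ⇓)) , resource-bounds loss σ↭ ⇓
  }
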